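{- Fix integers $q\ge 2$, $a\ge 1$, and $r_*\ge 1$. There exists $\varepsilon_0=\varepsilon_0(q,a,r_*)>0$ such that the following holds. Let $X$ be a finite set. For each $i\in[q]$, let $(\Omega_i,\mu_i)$ be a finite probability space, let $A_i(x)\subseteq\Omega_i$ be a measurable event for each $x\in X$, and let $\mathcal C_i$ be a hypergraph on $X$ whose edges are nonempty and whose rank is at most $r_*$. Write $\rho_i(x)=\mu_i(A_i(x))$. Suppose that $0\le\varepsilon\le\varepsilon_0$ and that: (A1) for every $x\in X$, $\displaystyle\sum_{i=1}^q\rho_i(x)\ge q-1-\varepsilon$; (A2) for every $a$-element subset $S\subseteq X$, $\displaystyle\min_{i\in[q]}\mu_i\Bigl(\bigcap_{x\in S}A_i(x)\Bigr)\le\varepsilon$; (A3) for every $i\in[q]$ and every $E\in\mathcal C_i$, $\displaystyle\min_{j\ne i}\mu_j\Bigl(\bigcap_{x\in E}A_j(x)\Bigr)\le\varepsilon$. Then there are $Z\subseteq X$ with $|Z|\le a-1$ and a partition \[ X\setminus Z=X_1\mathbin{\dot\cup}\cdots\mathbin{\dot\cup}X_q \] such that $X_i$ is independent in $\mathcal C_i$ for every $i\in[q]$.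
   Context: $[q]=\{1,\ldots,q\}$. The rank of a hypergraph is the maximum order of an edge (and $0$ for the hypergraph with no edges). A set is independent in a hypergraph if it contains no hyperedge as a subset. Parts of a partition may be empty. -}

module Defs where

open import Data.Bool.Base using (if_then_else_)
open import Data.Fin.Base using (Fin)
open import Data.Fin.Subset using (Subset; _⊆_; ⋂; ∣_∣)
open import Data.Fin.Subset.Properties using (_∈?_)
open import Data.Integer.Base as ℤ using (1ℤ; +_)
import Data.Integer.Properties as ℤ
open import Data.List.Base using (List; []; _∷_; map; foldr; filter; allFin)
open import Data.List.Membership.Propositional using (_∈_)
open import Data.Nat.Base as ℕ using (ℕ; suc)
open import Data.Nat.Coprimality using (1-coprimeTo)
import Data.Nat.Solver as ℕSolver
open import Data.Product.Base using (∃-syntax; _×_)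
open import Data.Rational.Base using (ℚ; mkℚ; 0ℚ; 1ℚ; _/_; _+_; -_; _⊓_; _≤_; _<_; toℚᵘ)
import Data.Rational.Properties as ℚ
import Data.Rational.Solver as ℚSolver
open import Data.Rational.Unnormalised.Base as ℚᵘ using (mkℚᵘ; *≡*)
import Data.Rational.Unnormalised.Properties as ℚᵘ
open import Data.Vec.Base using (lookup)
open import Relation.Binary.PropositionalEquality using (_≡_; refl; sym; trans; cong; cong₂)
import Relation.Binary.Reasoning.Setoid as SetoidReasoning
open import Relation.Nullary using (¬_)

------------------------------------------------------------------------
-- Real numbers as regular Cauchy sequences of rationals (Bishop)

-- δ n = 1 / (n + 1)
δ : ℕ → ℚ
δ n = mkℚ 1ℤ n (1-coprimeTo (suc n))

-- Read with m and n exchanged as well, this is Bishop's condition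
-- ∣ s m - s n ∣ ≤ δ m + δ n; the n-th term is within δ n of the limit.
Regular : (ℕ → ℚ) → Set
Regular s = ∀ m n → s m ≤ s n + (δ m + δ n)

record ℝ : Set where
  constructor mkℝ
  field
    seq     : ℕ → ℚ
    regular : Regular seq

open ℝ public

infix  8 -ℝ_
infixl 7 _⊓ℝ_
infixl 6 _+ℝ_ _-ℝ_
infix  4 _≤ℝ_ _<ℝ_ _≃ℝ_

-- δ n + δ n bounds the total error of the n-th approximations of x and y.
_≤ℝ_ : ℝ → ℝ → Set
x ≤ℝ y = ∀ n → seq x n ≤ seq y n + (δ n + δ n)

_<ℝ_ : ℝ → ℝ → Set
x <ℝ y = ∃[ n ] seq x n + (δ n + δ n) < seq y n

_≃ℝ_ : ℝ → ℝ → Set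
x ≃ℝ y = x ≤ℝ y × y ≤ℝ x

double : ℕ → ℕ
double n = suc (2 ℕ.* n)

-- Abstract because unfolding these proofs makes type checking infeasible.
abstract
  δ-double : ∀ n → δ (double n) + δ (double n) ≡ δ n
  δ-double n = ℚ.toℚᵘ-injective (begin
    toℚᵘ (δ k + δ k)          ≈⟨ ℚ.toℚᵘ-homo-+ (δ k) (δ k) ⟩
    mkℚᵘ 1ℤ k ℚᵘ.+ mkℚᵘ 1ℤ k  ≈⟨ *≡* cross ⟩
    mkℚᵘ 1ℤ n                 ∎)
    where
    open SetoidReasoning ℚᵘ.≃-setoid

    k : ℕ
    k = double n

    crossℕ : (suc k ℕ.+ suc k) ℕ.* suc n ≡ suc k ℕ.* suc k
    crossℕ = solve 1 (λ m → let s = con 2 :+ con 2 :* m in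
                        (s :+ s) :* (con 1 :+ m) := s :* s) refl n
      where open ℕSolver.+-*-Solver

    cross : (1ℤ ℤ.* + suc k ℤ.+ 1ℤ ℤ.* + suc k) ℤ.* + suc n ≡ 1ℤ ℤ.* + (suc k ℕ.* suc k)
    cross = trans
      (cong (ℤ._* + suc n) (cong₂ ℤ._+_ (ℤ.*-identityˡ (+ suc k)) (ℤ.*-identityˡ (+ suc k))))
      (trans (cong +_ crossℕ) (sym (ℤ.*-identityˡ (+ (suc k ℕ.* suc k)))))

  0≤δ : ∀ n → 0ℚ ≤ δ n
  0≤δ n = ℚ.nonNegative⁻¹ (δ n)

  fromℚ-regular : ∀ p → Regular (λ _ → p)
  fromℚ-regular p m n = begin
    p                ≡⟨ ℚ.+-identityʳ p ⟨
    p + 0ℚ           ≤⟨ ℚ.+-monoʳ-≤ p (ℚ.+-mono-≤ (0≤δ m) (0≤δ n)) ⟩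
    p + (δ m + δ n)  ∎
    where open ℚ.≤-Reasoning

  +ℝ-regular : ∀ x y → Regular (λ n → seq x (double n) + seq y (double n))
  +ℝ-regular x y m n =
    let m′ = double m
        n′ = double n
    in begin
    seq x m′ + seq y m′
      ≤⟨ ℚ.+-mono-≤ (regular x m′ n′) (regular y m′ n′) ⟩
    (seq x n′ + (δ m′ + δ n′)) + (seq y n′ + (δ m′ + δ n′))
      ≡⟨ rearrange (seq x n′) (seq y n′) (δ m′) (δ n′) ⟩
    (seq x n′ + seq y n′) + ((δ m′ + δ m′) + (δ n′ + δ n′))
      ≡⟨ cong₂ _+_ (refl {x = seq x n′ + seq y n′}) (cong₂ _+_ (δ-double m) (δ-double n)) ⟩
    (seq x n′ + seq y n′) + (δ m + δ n) ∎
    where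
    open ℚ.≤-Reasoning
    rearrange : ∀ a b c d → (a + (c + d)) + (b + (c + d)) ≡ (a + b) + ((c + c) + (d + d))
    rearrange = solve 4 (λ a b c d → (a :+ (c :+ d)) :+ (b :+ (c :+ d))
                                  := (a :+ b) :+ ((c :+ c) :+ (d :+ d))) refl
      where open ℚSolver.+-*-Solver

  -ℝ-regular : ∀ x → Regular (λ n → - seq x n)
  -ℝ-regular x m n = begin
    - seq x m
      ≡⟨ shift (seq x m) (δ m) (δ n) ⟩
    - (seq x m + (δ n + δ m)) + (δ m + δ n)
      ≤⟨ ℚ.+-monoˡ-≤ (δ m + δ n) (ℚ.neg-antimono-≤ (regular x n m)) ⟩
    - seq x n + (δ m + δ n) ∎
    where
    open ℚ.≤-Reasoning
    shift : ∀ a c d → - a ≡ - (a + (d + c)) + (c + d)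
    shift = solve 3 (λ a c d → :- a := :- (a :+ (d :+ c)) :+ (c :+ d)) refl
      where open ℚSolver.+-*-Solver

  ⊓ℝ-regular : ∀ x y → Regular (λ n → seq x n ⊓ seq y n)
  ⊓ℝ-regular x y m n = begin
    seq x m ⊓ seq y m
      ≤⟨ ℚ.⊓-mono-≤ (regular x m n) (regular y m n) ⟩
    (seq x n + (δ m + δ n)) ⊓ (seq y n + (δ m + δ n))
      ≡⟨ ℚ.mono-≤-distrib-⊓ (ℚ.+-monoˡ-≤ (δ m + δ n)) (seq x n) (seq y n) ⟨
    (seq x n ⊓ seq y n) + (δ m + δ n) ∎
    where open ℚ.≤-Reasoning

fromℚ : ℚ → ℝ
fromℚ p = mkℝ (λ _ → p) (fromℚ-regular p)

fromℕ : ℕ → ℝ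
fromℕ n = fromℚ (+ n / 1)

0ℝ 1ℝ : ℝ
0ℝ = fromℚ 0ℚ
1ℝ = fromℚ 1ℚ

-- The n-th term uses the (2n+1)-st terms of x and y, as δ (2n+1) = δ n / 2.
_+ℝ_ : ℝ → ℝ → ℝ
x +ℝ y = mkℝ (λ n → seq x (double n) + seq y (double n)) (+ℝ-regular x y)

-ℝ_ : ℝ → ℝ
-ℝ x = mkℝ (λ n → - seq x n) (-ℝ-regular x)

_-ℝ_ : ℝ → ℝ → ℝ
x -ℝ y = x +ℝ (-ℝ y)

_⊓ℝ_ : ℝ → ℝ → ℝ
x ⊓ℝ y = mkℝ (λ n → seq x n ⊓ seq y n) (⊓ℝ-regular x y)

sum : List ℝ → ℝ
sum = foldr _+ℝ_ 0ℝ

-- The value on the empty list is a placeholder.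
minimum : List ℝ → ℝ
minimum []           = 0ℝ
minimum (x ∷ [])     = x
minimum (x ∷ y ∷ xs) = x ⊓ℝ minimum (y ∷ xs)

------------------------------------------------------------------------
-- Finite probability spaces; every subset of the sample space is an event

record FiniteProbabilitySpace : Set where
  field
    size     : ℕ
    mass     : Fin size → ℝ
    mass-≥0  : ∀ ω → 0ℝ ≤ℝ mass ω
    mass-sum : sum (map mass (allFin size)) ≃ℝ 1ℝ

open FiniteProbabilitySpace public

Event : FiniteProbabilitySpace → Set
Event Ω = Subset (size Ω)

ℙ : (Ω : FiniteProbabilitySpace) → Event Ω → ℝ
ℙ Ω B = sum (map (λ ω → if lookup B ω then mass Ω ω else 0ℝ) (allFin (size Ω)))

⋂[_]_ : ∀ {m n} → Subset n → (Fin n → Subset m) → Subset m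
⋂[ S ] A = ⋂ (map A (filter (_∈? S) (allFin _)))

------------------------------------------------------------------------
-- Hypergraphs on the vertex set Fin n

-- A finite set of edges, given by an enumeration; order and repetitions are
-- irrelevant to the notions below.
Hypergraph : ℕ → Set
Hypergraph n = List (Subset n)

rank : ∀ {n} → Hypergraph n → ℕ
rank 𝒞 = foldr ℕ._⊔_ 0 (map ∣_∣ 𝒞)

Independent : ∀ {n} → Hypergraph n → Subset n → Set
Independent 𝒞 S = ∀ E → E ∈ 𝒞 → ¬ (E ⊆ S)

-- Write H x for the least of the ρ i x and call a coordinate attaining it the leader of x. By (A1)
-- the other coordinates satisfy 1 - ρ j x ≤ H x + ε and ρ j x ≥ 1/3, so H x ≤ 3^q ∏ ρ i x. By (A2)
-- almost every point of the product space lies in the events of at most a vertices, so H has a sum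
-- of at most a constant κ on every set of bounded size. Therefore only boundedly many x satisfy
-- H x > 1/c, and of K consecutive scales c < c′ that grow fast enough one has a light band
-- B = {1/c′ < H x ≤ 1/c}, on which the sum of H is small. Let F = {H x > 1/c}.
--
-- Vertices outside F are coloured by their leader. For F, choose ω i in each Ω i outside the
-- following sets: the events of small measure that are intersections over subsets of F; the
-- complements of the events of vertices of B that i does not lead; and, among the points left,
-- the intersections over subsets of F that have become small. The expected number of pairs (i, x)
-- with x ∈ F and ω i ∉ A i x is at most ∣F∣ (1 + ε). Since fewer than a vertices of F are missed by
-- no i, avoiding the last two kinds of sets only has to be paid for with weight a, independent of
-- ∣F∣; so ω can be chosen with at most ∣F∣ such pairs. Then the set Z of the vertices of F missed at
-- least twice is no larger than the set of those never missed, and every other vertex of F gets a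
-- colour i with ω j ∈ A j x for all j ≢ i. If all vertices of E have colour i, then for j ≢ i the
-- intersection of the A j x over x ∈ E ∩ (F ∪ B) is large, and the remaining vertices of E have
-- 1 - ρ j x of size 1/c′, which is much smaller; so E is not an edge by (A3).

module Submission where

open import Data.Bool.Base using (Bool; true; false; if_then_else_)
open import Data.Fin.Base using (Fin; zero; suc; fromℕ<)
open import Data.Fin.Properties using (_≟_; all?; any?; ¬∀⟶∃¬)
open import Data.Fin.Subset using (Subset; inside; outside; Nonempty; Empty; _⊆_; _∉_; _∩_; ∁; ⋂; ⋃; ∣_∣) renaming (_∈_ to _∈ˢ_)
open import Data.Fin.Subset.Properties using (_∈?_; p⊆q⇒∣p∣≤∣q∣; x∈p∩q⁻; x∈p∩q⁺; p∩q⊆q; s⊆s; out⊆; drop-∷-⊆; ∈⊤; ∉⊥; x∈p∪q⁻; x∈p∪q⁺; drop-there; x∈∁p⇒x∉p; x∉p⇒x∈∁p; ⊆-antisym; Empty-unique; ∣⊥∣≡0; nonempty?)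
open import Data.Integer.Base as ℤ using (1ℤ) renaming (+_ to +ℤ_)
import Data.Integer.Properties as ℤ
open import Data.List.Base using (List; []; _∷_; map; tabulate; filter; allFin)
open import Data.List.Membership.Propositional using (_∈_; find; lose)
open import Data.List.Membership.Propositional.Properties using (∈-filter⁺; ∈-filter⁻; ∈-allFin)
open import Data.List.Properties using (map-tabulate)
open import Data.List.Relation.Unary.Any as Any using (here; there)
open import Data.Nat.Base
open import Data.Nat.Properties renaming (_≟_ to _≟ⁿ_)
open import Data.Nat.Tactic.RingSolver using (solve-∀)
open import Data.Product.Base using (∃; Σ-syntax; _×_; _,_; proj₁; proj₂)
open import Data.Rational.Base as ℚ using (ℚ; mkℚ; 0ℚ; 1ℚ; toℚᵘ)
import Data.Rational.Properties as ℚ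
import Data.Rational.Solver as ℚ
open import Data.Rational.Unnormalised.Base as ℚᵘ using (mkℚᵘ; *≡*; *<*)
import Data.Rational.Unnormalised.Properties as ℚᵘ
open import Data.Sum.Base using (_⊎_; inj₁; inj₂)
open import Data.Vec.Base as Vec using ([]; _∷_; here; there)
open import Data.Vec.Properties using (lookup⇒[]=; []=⇒lookup; lookup∘tabulate)
open import Defs
open import Function.Base using (_∘_; id; const)
open import Relation.Binary.PropositionalEquality
open import Relation.Nullary
open import Relation.Nullary.Decidable using (dec-true; dec-false; decidable-stable)
open import Relation.Unary using (Decidable)

open import Algebra.Properties.CommutativeSemigroup *-commutativeSemigroup using (x∙yz≈y∙xz)
open import Algebra.Properties.Monoid.Mult ℚ.+-0-monoid using (×-homo-+) renaming (_×_ to _·_)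
open import Algebra.Properties.Monoid.Sum *-1-monoid using () renaming (sum to ∏)
open import Algebra.Properties.Semiring.Sum +-*-semiring using (∑-distrib-+; *-distribˡ-sum; sum-cong-≗) renaming (sum to ∑)

private
  variable
    n q : ℕ
    P Q : Set
    Ω : Set

-- Indicators, finite sums and finite products of natural numbers.

𝟙 : Dec P → ℕ
𝟙 d = if does d then 1 else 0

𝟙-yes : (d : Dec P) → P → 𝟙 d ≡ 1
𝟙-yes d p rewrite dec-true d p = refl

𝟙-no : (d : Dec P) → ¬ P → 𝟙 d ≡ 0
𝟙-no d ¬p rewrite dec-false d ¬p = refl

𝟙≤1 : (d : Dec P) → 𝟙 d ≤ 1
𝟙≤1 (yes _) = ≤-refl
𝟙≤1 (no _)  = z≤n

𝟙-mono : (d : Dec P) (e : Dec Q) → (P → Q) → 𝟙 d ≤ 𝟙 e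
𝟙-mono (yes p) e f rewrite 𝟙-yes e (f p) = ≤-refl
𝟙-mono (no _)  e f = z≤n

𝟙-≤ : ∀ {k} (d : Dec P) → (P → 1 ≤ k) → 𝟙 d ≤ k
𝟙-≤ (yes p) f = f p
𝟙-≤ (no _)  f = z≤n

𝟙-¬? : (d : Dec P) → 𝟙 d + 𝟙 (¬? d) ≡ 1
𝟙-¬? (yes _) = refl
𝟙-¬? (no _)  = refl

∑-mono : {f g : Fin n → ℕ} → (∀ i → f i ≤ g i) → ∑ f ≤ ∑ g
∑-mono {zero}  f≤g = z≤n
∑-mono {suc n} f≤g = +-mono-≤ (f≤g zero) (∑-mono (f≤g ∘ suc))

term≤∑ : (f : Fin n → ℕ) → ∀ i → f i ≤ ∑ f
term≤∑ f zero    = m≤m+n _ _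
term≤∑ f (suc i) = ≤-trans (term≤∑ (f ∘ suc) i) (m≤n+m _ _)

two-terms≤∑ : (f : Fin n → ℕ) → ∀ {i j} → i ≢ j → f i + f j ≤ ∑ f
two-terms≤∑ f {zero}  {zero}  i≢j = contradiction refl i≢j
two-terms≤∑ f {zero}  {suc j} i≢j = +-monoʳ-≤ _ (term≤∑ (f ∘ suc) j)
two-terms≤∑ f {suc i} {zero}  i≢j =
  subst (_≤ ∑ f) (+-comm (f zero) _) (+-monoʳ-≤ _ (term≤∑ (f ∘ suc) i))
two-terms≤∑ f {suc i} {suc j} i≢j =
  ≤-trans (two-terms≤∑ (f ∘ suc) (i≢j ∘ cong suc)) (m≤n+m _ _)

∑-const : ∀ n c → ∑ {n} (const c) ≡ n * c
∑-const zero    c = refl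
∑-const (suc n) c = cong (c +_) (∑-const n c)

argmin : .{{_ : NonZero n}} (f : Fin n → ℕ) → ∃ λ i → ∀ j → f i ≤ f j
argmin {1}           f = zero , λ { zero → ≤-refl }
argmin {suc (suc n)} f with argmin (f ∘ suc)
... | i , fi≤ with f zero ≤? f (suc i)
...   | yes f0≤ = zero , λ { zero → ≤-refl ; (suc j) → ≤-trans f0≤ (fi≤ j) }
...   | no  f0≰ = suc i , λ { zero → <⇒≤ (≰⇒> f0≰) ; (suc j) → fi≤ j }

∏-^ : ∀ {D} (t : Fin n → ℕ) → (∀ i → t i ≤ D) → ∏ t ≤ D ^ n
∏-^ {zero}  t t≤ = ≤-refl
∏-^ {suc n} t t≤ = *-mono-≤ (t≤ zero) (∏-^ (t ∘ suc) (t≤ ∘ suc))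

∏-small : ∀ {D} N (t : Fin n → ℕ) → (∀ i → t i ≤ D) →
          ∀ i → N * t i ≤ D → N * ∏ t ≤ D ^ n
∏-small {suc n} {D} N t t≤ zero    Nt≤ = begin
  N * (t zero * ∏ (t ∘ suc))  ≡⟨ *-assoc N _ _ ⟨
  N * t zero * ∏ (t ∘ suc)    ≤⟨ *-mono-≤ Nt≤ (∏-^ (t ∘ suc) (t≤ ∘ suc)) ⟩
  D * D ^ n                   ∎
  where open ≤-Reasoning
∏-small {suc n} {D} N t t≤ (suc i) Nt≤ = begin
  N * (t zero * ∏ (t ∘ suc))  ≡⟨ x∙yz≈y∙xz N (t zero) _ ⟩
  t zero * (N * ∏ (t ∘ suc))  ≤⟨ *-mono-≤ (t≤ zero) (∏-small N (t ∘ suc) (t≤ ∘ suc) i Nt≤) ⟩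
  D * D ^ n                   ∎
  where
  open ≤-Reasoning

^-≤-∏ : ∀ {D c} (t : Fin n → ℕ) → (∀ i → D ≤ c * t i) → D ^ n ≤ c ^ n * ∏ t
^-≤-∏ {zero}          t ≤t = ≤-refl
^-≤-∏ {suc n} {D} {c} t ≤t = begin
  D * D ^ n                              ≤⟨ *-mono-≤ (≤t zero) (^-≤-∏ (t ∘ suc) (≤t ∘ suc)) ⟩
  c * t zero * (c ^ n * ∏ (t ∘ suc))     ≡⟨ lemma c (t zero) (c ^ n) _ ⟩
  c * c ^ n * (t zero * ∏ (t ∘ suc))     ∎
  where
  open ≤-Reasoning
  lemma : ∀ a b c d → a * b * (c * d) ≡ a * c * (b * d)
  lemma = solve-∀

-- The factor `t i` is kept and every other factor is at least `D / c`. Only `n - 1` factors `c` are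
-- needed; allowing `c ^ n` keeps the induction uniform.
∏-large : ∀ {D c} .{{_ : NonZero c}} (t : Fin n → ℕ) i → (∀ j → j ≢ i → D ≤ c * t j) →
          t i * D ^ n ≤ c ^ n * (D * ∏ t)
∏-large {suc n} {D} {c} t zero ≤t = begin
  t zero * (D * D ^ n)                     ≤⟨ *-monoʳ-≤ (t zero) (*-monoʳ-≤ D (^-≤-∏ (t ∘ suc) (λ j → ≤t (suc j) λ ()))) ⟩
  t zero * (D * (c ^ n * ∏ (t ∘ suc)))     ≡⟨ lemma (t zero) D (c ^ n) _ ⟩
  c ^ n * (D * (t zero * ∏ (t ∘ suc)))     ≤⟨ *-monoˡ-≤ _ (m≤n*m (c ^ n) c) ⟩
  c * c ^ n * (D * (t zero * ∏ (t ∘ suc))) ∎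
  where
  open ≤-Reasoning
  lemma : ∀ a d b e → a * (d * (b * e)) ≡ b * (d * (a * e))
  lemma = solve-∀
∏-large {suc n} {D} {c} t (suc i) ≤t = begin
  t (suc i) * (D * D ^ n)                     ≡⟨ x∙yz≈y∙xz (t (suc i)) D (D ^ n) ⟩
  D * (t (suc i) * D ^ n)                     ≤⟨ *-mono-≤ (≤t zero λ ()) (∏-large (t ∘ suc) i λ j j≢i → ≤t (suc j) λ { refl → j≢i refl }) ⟩
  c * t zero * (c ^ n * (D * ∏ (t ∘ suc)))    ≡⟨ lemma′ c (t zero) (c ^ n) D _ ⟩
  c * c ^ n * (D * (t zero * ∏ (t ∘ suc)))    ∎
  where
  open ≤-Reasoning
  lemma′ : ∀ a b c d e → a * b * (c * (d * e)) ≡ a * c * (d * (b * e))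
  lemma′ = solve-∀

-- Linear functionals, weightings and product measures.

record Linear (L : (Ω → ℕ) → ℕ) : Set where
  field
    mono  : ∀ {f g} → (∀ ω → f ω ≤ g ω) → L f ≤ L g
    +-hom : ∀ f g → L (λ ω → f ω + g ω) ≡ L f + L g
    *-hom : ∀ c f → L (λ ω → c * f ω) ≡ c * L f

  cong-≗ : ∀ {f g} → f ≗ g → L f ≡ L g
  cong-≗ f≗g = ≤-antisym (mono (≤-reflexive ∘ f≗g)) (mono (≤-reflexive ∘ sym ∘ f≗g))

  const-hom : ∀ c → L (const c) ≡ c * L (const 1)
  const-hom c = trans (cong-≗ (λ _ → sym (*-identityʳ c))) (*-hom c (const 1))

  ∑-hom : (g : Fin n → Ω → ℕ) → L (λ ω → ∑ λ x → g x ω) ≡ ∑ λ x → L (g x)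
  ∑-hom {zero}  g = *-hom 0 (const 0)
  ∑-hom {suc n} g = trans (+-hom (g zero) _) (cong (L (g zero) +_) (∑-hom (g ∘ suc)))

-- A finite probability space whose masses are multiples of `1 / D`, scaled by `D`. Thus `∫` is `D`
-- times the expectation, and all estimates stay in the natural numbers.
record Weighting (D : ℕ) : Set where
  field
    points   : ℕ
    weight : Fin points → ℕ
    total  : ∑ weight ≡ D

  ∫ : (Fin points → ℕ) → ℕ
  ∫ f = ∑ λ ω → weight ω * f ω

  ∫-linear : Linear ∫
  ∫-linear = record
    { mono  = λ f≤g → ∑-mono λ ω → *-monoʳ-≤ (weight ω) (f≤g ω)
    ; +-hom = λ f g → trans
        (sum-cong-≗ λ ω → *-distribˡ-+ (weight ω) (f ω) (g ω))
        (∑-distrib-+ (λ ω → weight ω * f ω) λ ω → weight ω * g ω)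
    ; *-hom = λ c f → trans
        (sum-cong-≗ λ ω → x∙yz≈y∙xz (weight ω) c (f ω))
        (sym (*-distribˡ-sum c λ ω → weight ω * f ω))
    }

  ∫-1 : ∫ (const 1) ≡ D
  ∫-1 = trans (sum-cong-≗ (*-identityʳ ∘ weight)) total

  open Linear ∫-linear public

  ∫-const : ∀ c → ∫ (const c) ≡ c * D
  ∫-const c = trans (const-hom c) (cong (c *_) ∫-1)

  ∫-≤1 : ∀ {f} → (∀ ω → f ω ≤ 1) → ∫ f ≤ D
  ∫-≤1 f≤1 = ≤-trans (mono f≤1) (≤-reflexive ∫-1)

-- The first moment method: the minimum of `φ` is at most its mean. A positive total mass guarantees
-- that there is a point at all.
average : ∀ {D} .{{_ : NonZero D}} (μ : Weighting D) → let open Weighting μ in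
          (φ : Fin points → ℕ) → ∃ λ ω → D * φ ω ≤ ∫ φ
average {D} record { points = zero ; total = total } φ = contradiction (sym total) (≢-nonZero⁻¹ D)
average {D} μ@record { points = suc _ } φ with argmin φ
... | ω , least = ω , (begin
  D * φ ω          ≡⟨ *-comm D (φ ω) ⟩
  φ ω * D          ≡⟨ ∫-const (φ ω) ⟨
  ∫ (const (φ ω))  ≤⟨ mono least ⟩
  ∫ φ              ∎)
  where
  open ≤-Reasoning
  open Weighting μ

cons : {Ω : Fin (suc q) → Set} → Ω zero → (∀ i → Ω (suc i)) → ∀ i → Ω i
cons ω₀ ω zero    = ω₀
cons ω₀ ω (suc i) = ω i

-- The product measure, as an iterated integral.
⨂ : {Ω : Fin q → Set} → (∀ i → (Ω i → ℕ) → ℕ) → ((∀ i → Ω i) → ℕ) → ℕ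
⨂ {zero}  L f = f λ ()
⨂ {suc q} L f = L zero λ ω₀ → ⨂ (L ∘ suc) (f ∘ cons ω₀)

module _ where
  open Linear

  ⨂-linear : {Ω : Fin q → Set} {L : ∀ i → (Ω i → ℕ) → ℕ} → (∀ i → Linear (L i)) → Linear (⨂ L)
  ⨂-linear {zero} _ = record
    { mono = λ f≤g → f≤g _ ; +-hom = λ _ _ → refl ; *-hom = λ _ _ → refl }
  ⨂-linear {suc q} lin = record
    { mono  = λ f≤g → mono L₀ λ ω₀ → mono L₊ λ ω → f≤g _
    ; +-hom = λ f g → trans (cong-≗ L₀ λ ω₀ → +-hom L₊ (f ∘ cons ω₀) (g ∘ cons ω₀)) (+-hom L₀ _ _)
    ; *-hom = λ c f → trans (cong-≗ L₀ λ ω₀ → *-hom L₊ c (f ∘ cons ω₀)) (*-hom L₀ c _)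
    }
    where
    L₀ = lin zero
    L₊ = ⨂-linear (lin ∘ suc)

  -- Independence of the coordinates: each factor depends on one coordinate only and is pulled out
  -- of the other integrals.
  ⨂-∏ : {Ω : Fin q → Set} {L : ∀ i → (Ω i → ℕ) → ℕ} → (∀ i → Linear (L i)) →
        (g : ∀ i → Ω i → ℕ) → ⨂ L (λ ω → ∏ λ i → g i (ω i)) ≡ ∏ λ i → L i (g i)
  ⨂-∏ {zero}          lin g = refl
  ⨂-∏ {suc q} {L = L} lin g = begin
    L zero (λ ω₀ → ⨂ (L ∘ suc) λ ω → g zero ω₀ * ∏ λ i → g (suc i) (ω i))
      ≡⟨ cong-≗ (lin zero) (λ ω₀ → trans (*-hom (⨂-linear (lin ∘ suc)) (g zero ω₀) _)
           (trans (cong (g zero ω₀ *_) (⨂-∏ (lin ∘ suc) (g ∘ suc))) (*-comm (g zero ω₀) _))) ⟩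
    L zero (λ ω₀ → ∏ (λ i → L (suc i) (g (suc i))) * g zero ω₀)
      ≡⟨ *-hom (lin zero) (∏ λ i → L (suc i) (g (suc i))) (g zero) ⟩
    ∏ (λ i → L (suc i) (g (suc i))) * L zero (g zero)
      ≡⟨ *-comm _ (L zero (g zero)) ⟩
    L zero (g zero) * ∏ (λ i → L (suc i) (g (suc i))) ∎
    where open ≡-Reasoning

-- Subsets of `Fin n` and sums over them.

select : {P : Fin n → Set} → Decidable P → Subset n
select P? = Vec.tabulate (does ∘ P?)

module _ {P : Fin n → Set} (P? : Decidable P) {x : Fin n} where

  select⁺ : P x → x ∈ˢ select P?
  select⁺ p = lookup⇒[]= x _ (trans (lookup∘tabulate (does ∘ P?) x) (dec-true (P? x) p))

  select⁻ : x ∈ˢ select P? → P x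
  select⁻ x∈ with P? x in eq
  ... | yes p = p
  ... | no _  = contradiction
    (trans (sym ([]=⇒lookup x∈)) (trans (lookup∘tabulate (does ∘ P?) x) (cong does eq))) λ ()

∣S∣≡∑ : (S : Subset n) → ∣ S ∣ ≡ ∑ λ x → 𝟙 (x ∈? S)
∣S∣≡∑ []            = refl
∣S∣≡∑ (inside  ∷ S) = cong suc (∣S∣≡∑ S)
∣S∣≡∑ (outside ∷ S) = ∣S∣≡∑ S

shrink : ∀ {k} (S : Subset n) → k ≤ ∣ S ∣ → ∃ λ T → T ⊆ S × ∣ T ∣ ≡ k
shrink             []            z≤n = [] , id , refl
shrink             (outside ∷ S) k≤ with T , T⊆S , ∣T∣ ← shrink S k≤ = outside ∷ T , s⊆s T⊆S , ∣T∣
shrink {k = zero}  (inside  ∷ S) k≤ with T , T⊆S , ∣T∣ ← shrink S z≤n = outside ∷ T , out⊆ T⊆S , ∣T∣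
shrink {k = suc k} (inside  ∷ S) (s≤s k≤) with T , T⊆S , ∣T∣ ← shrink S k≤ =
  inside ∷ T , s⊆s T⊆S , cong suc ∣T∣

∑⊆ : Subset n → (Subset n → ℕ) → ℕ
∑⊆ []            f = f []
∑⊆ (outside ∷ Y) f = ∑⊆ Y (f ∘ (outside ∷_))
∑⊆ (inside  ∷ Y) f = ∑⊆ Y (f ∘ (outside ∷_)) + ∑⊆ Y (f ∘ (inside ∷_))

term≤∑⊆ : ∀ {S Y} (f : Subset n → ℕ) → S ⊆ Y → f S ≤ ∑⊆ Y f
term≤∑⊆ {S = []}          {[]}          f S⊆Y = ≤-refl
term≤∑⊆ {S = outside ∷ S} {outside ∷ Y} f S⊆Y = term≤∑⊆ (f ∘ (outside ∷_)) (drop-∷-⊆ S⊆Y)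
term≤∑⊆ {S = inside  ∷ S} {outside ∷ Y} f S⊆Y = contradiction (S⊆Y here) λ ()
term≤∑⊆ {S = outside ∷ S} {inside  ∷ Y} f S⊆Y =
  ≤-trans (term≤∑⊆ (f ∘ (outside ∷_)) (drop-∷-⊆ S⊆Y)) (m≤m+n _ _)
term≤∑⊆ {S = inside  ∷ S} {inside  ∷ Y} f S⊆Y =
  ≤-trans (term≤∑⊆ (f ∘ (inside ∷_)) (drop-∷-⊆ S⊆Y)) (m≤n+m _ _)

-- Linearity over the `2 ^ ∣ Y ∣` subsets of `Y`. For indicators `f S` this acts as a union bound.
∑⊆-bound : ∀ {L : (Ω → ℕ) → ℕ} {D} N → Linear L →
           (Y : Subset n) (f : Subset n → Ω → ℕ) → (∀ S → N * L (f S) ≤ D) →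
           N * L (λ ω → ∑⊆ Y λ S → f S ω) ≤ 2 ^ ∣ Y ∣ * D
∑⊆-bound {D = D} N lin [] f Nf≤ = ≤-trans (Nf≤ []) (≤-reflexive (sym (+-identityʳ D)))
∑⊆-bound N lin (outside ∷ Y) f Nf≤ = ∑⊆-bound N lin Y (f ∘ (outside ∷_)) (Nf≤ ∘ (outside ∷_))
∑⊆-bound {L = L} {D} N lin (inside ∷ Y) f Nf≤ = begin
  N * L (λ ω → ∑⊆ Y (λ S → f (outside ∷ S) ω) + ∑⊆ Y λ S → f (inside ∷ S) ω)
    ≡⟨ cong (N *_) (Linear.+-hom lin _ _) ⟩
  N * (L (λ ω → ∑⊆ Y λ S → f (outside ∷ S) ω) + L (λ ω → ∑⊆ Y λ S → f (inside ∷ S) ω))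
    ≡⟨ *-distribˡ-+ N _ _ ⟩
  N * L (λ ω → ∑⊆ Y λ S → f (outside ∷ S) ω) + N * L (λ ω → ∑⊆ Y λ S → f (inside ∷ S) ω)
    ≤⟨ +-mono-≤ (∑⊆-bound N lin Y _ (Nf≤ ∘ (outside ∷_))) (∑⊆-bound N lin Y _ (Nf≤ ∘ (inside ∷_))) ⟩
  2 ^ ∣ Y ∣ * D + 2 ^ ∣ Y ∣ * D
    ≡⟨ twice (2 ^ ∣ Y ∣) D ⟩
  2 * 2 ^ ∣ Y ∣ * D ∎
  where
  open ≤-Reasoning
  twice : ∀ a d → a * d + a * d ≡ 2 * a * d
  twice = solve-∀

∑∈ : Subset n → (Fin n → ℕ) → ℕ
∑∈ S g = ∑ λ x → 𝟙 (x ∈? S) * g x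

∑∈-mono : ∀ (S : Subset n) {f g} → (∀ {x} → x ∈ˢ S → f x ≤ g x) → ∑∈ S f ≤ ∑∈ S g
∑∈-mono S {f} {g} f≤g = ∑-mono λ x → lemma x (x ∈? S)
  where
  lemma : ∀ x (d : Dec (x ∈ˢ S)) → 𝟙 d * f x ≤ 𝟙 d * g x
  lemma x (yes x∈S) = *-monoʳ-≤ 1 (f≤g x∈S)
  lemma x (no _)    = z≤n

∑∈-const : ∀ (S : Subset n) c → ∑∈ S (const c) ≡ ∣ S ∣ * c
∑∈-const S c = begin
  (∑ λ x → 𝟙 (x ∈? S) * c)  ≡⟨ sum-cong-≗ (λ x → *-comm (𝟙 (x ∈? S)) c) ⟩
  (∑ λ x → c * 𝟙 (x ∈? S))  ≡⟨ *-distribˡ-sum c (λ x → 𝟙 (x ∈? S)) ⟨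
  c * ∑ (λ x → 𝟙 (x ∈? S))  ≡⟨ cong (c *_) (∣S∣≡∑ S) ⟨
  c * ∣ S ∣                 ≡⟨ *-comm c ∣ S ∣ ⟩
  ∣ S ∣ * c                 ∎
  where open ≡-Reasoning

∑∈-+ : ∀ (S : Subset n) f g → ∑∈ S (λ x → f x + g x) ≡ ∑∈ S f + ∑∈ S g
∑∈-+ S f g = trans (sum-cong-≗ λ x → *-distribˡ-+ (𝟙 (x ∈? S)) (f x) (g x))
  (∑-distrib-+ (λ x → 𝟙 (x ∈? S) * f x) λ x → 𝟙 (x ∈? S) * g x)

∑∈-* : ∀ (S : Subset n) c g → ∑∈ S (λ x → c * g x) ≡ c * ∑∈ S g
∑∈-* S c g = trans (sum-cong-≗ λ x → x∙yz≈y∙xz (𝟙 (x ∈? S)) c (g x))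
  (sym (*-distribˡ-sum c λ x → 𝟙 (x ∈? S) * g x))

∑∈-bound : ∀ (S : Subset n) g {c e} → (∀ {x} → x ∈ˢ S → c * g x ≤ e) → c * ∑∈ S g ≤ ∣ S ∣ * e
∑∈-bound S g {c} {e} cg≤e = begin
  c * ∑∈ S g             ≡⟨ ∑∈-* S c g ⟨
  ∑∈ S (λ x → c * g x)   ≤⟨ ∑∈-mono S cg≤e ⟩
  ∑∈ S (const e)         ≡⟨ ∑∈-const S e ⟩
  ∣ S ∣ * e              ∎
  where open ≤-Reasoning

∑∈-⊆ : ∀ {S T : Subset n} g → S ⊆ T → ∑∈ S g ≤ ∑∈ T g
∑∈-⊆ {S = S} {T} g S⊆T = ∑-mono λ x → *-monoˡ-≤ (g x) (𝟙-mono (x ∈? S) (x ∈? T) S⊆T)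

∑∈-𝟙 : ∀ {S T : Subset n} → S ⊆ T → ∑∈ T (λ x → 𝟙 (x ∈? S)) ≡ ∣ S ∣
∑∈-𝟙 {S = S} {T} S⊆T = trans (sum-cong-≗ λ x → lemma x (x ∈? S)) (sym (∣S∣≡∑ S))
  where
  lemma : ∀ x (d : Dec (x ∈ˢ S)) → 𝟙 (x ∈? T) * 𝟙 d ≡ 𝟙 d
  lemma x (yes x∈S) = trans (*-identityʳ (𝟙 (x ∈? T))) (𝟙-yes (x ∈? T) (S⊆T x∈S))
  lemma x (no _)    = *-zeroʳ (𝟙 (x ∈? T))

∑∈-∪ : ∀ {R S T : Subset n} g → R ⊆ T → S ⊆ T → (∀ {x} → x ∈ˢ R → x ∉ S) →
       ∑∈ R g + ∑∈ S g ≤ ∑∈ T g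
∑∈-∪ {R = R} {S} {T} g R⊆T S⊆T disjoint = ≤-trans
  (≤-reflexive (sym (∑-distrib-+ (λ x → 𝟙 (x ∈? R) * g x) λ x → 𝟙 (x ∈? S) * g x)))
  (∑-mono λ x → ≤-trans (≤-reflexive (sym (*-distribʳ-+ (g x) (𝟙 (x ∈? R)) (𝟙 (x ∈? S)))))
                        (*-monoˡ-≤ (g x) (lemma x (x ∈? R) (x ∈? S))))
  where
  lemma : ∀ x (d : Dec (x ∈ˢ R)) (e : Dec (x ∈ˢ S)) → 𝟙 d + 𝟙 e ≤ 𝟙 (x ∈? T)
  lemma x (yes x∈R) (yes x∈S) = contradiction x∈S (disjoint x∈R)
  lemma x (yes x∈R) (no _)    = ≤-reflexive (sym (𝟙-yes (x ∈? T) (R⊆T x∈R)))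
  lemma x (no _)    (yes x∈S) = ≤-reflexive (sym (𝟙-yes (x ∈? T) (S⊆T x∈S)))
  lemma x (no _)    (no _)    = z≤n

term≤∑∈ : ∀ (S : Subset n) g {x} → x ∈ˢ S → g x ≤ ∑∈ S g
term≤∑∈ S g {x} x∈S = begin
  g x                ≡⟨ *-identityˡ (g x) ⟨
  1 * g x            ≡⟨ cong (_* g x) (𝟙-yes (x ∈? S) x∈S) ⟨
  𝟙 (x ∈? S) * g x   ≤⟨ term≤∑ (λ x → 𝟙 (x ∈? S) * g x) x ⟩
  ∑∈ S g             ∎
  where open ≤-Reasoning

∑∈-hom : {L : (Ω → ℕ) → ℕ} → Linear L → (S : Subset n) (g : Fin n → Ω → ℕ) →
         L (λ ω → ∑∈ S λ x → g x ω) ≡ ∑∈ S λ x → L (g x)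
∑∈-hom {L = L} lin S g = trans (Linear.∑-hom lin λ x ω → 𝟙 (x ∈? S) * g x ω)
  (sum-cong-≗ λ x → Linear.*-hom lin (𝟙 (x ∈? S)) (g x))

∑-linear : Linear (∑ {n})
∑-linear = record
  { mono = ∑-mono ; +-hom = ∑-distrib-+ ; *-hom = λ c f → sym (*-distribˡ-sum c f) }

*-small⇒≡0 : ∀ {k} x → k * x < k → x ≡ 0
*-small⇒≡0 zero    _   = refl
*-small⇒≡0 {k} (suc x) kx<k = contradiction (m≤m*n k (suc x)) (<⇒≱ kx<k)

∏-𝟙-yes : {P : Fin q → Set} (d : ∀ i → Dec (P i)) → (∀ i → P i) → ∏ (𝟙 ∘ d) ≡ 1
∏-𝟙-yes {zero}  d p = refl
∏-𝟙-yes {suc q} d p = cong₂ _*_ (𝟙-yes (d zero) (p zero)) (∏-𝟙-yes (d ∘ suc) (p ∘ suc))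

∏-𝟙-no : {P : Fin q → Set} (d : ∀ i → Dec (P i)) → ∀ i → ¬ P i → ∏ (𝟙 ∘ d) ≡ 0
∏-𝟙-no d zero    ¬p = cong (_* ∏ (𝟙 ∘ d ∘ suc)) (𝟙-no (d zero) ¬p)
∏-𝟙-no d (suc i) ¬p = trans (cong (𝟙 (d zero) *_) (∏-𝟙-no (d ∘ suc) i ¬p)) (*-zeroʳ (𝟙 (d zero)))

-- If no increment is small, each of the `K` increments of `θ * g` is at least `suc D`, and they
-- telescope. This is the pigeonhole step that finds the light band.
small-increment : (g : ℕ → ℕ) (θ D : ℕ) → ∀ K →
  (∃ λ k → k < K × θ * g (suc k) ≤ θ * g k + D) ⊎ K * suc D ≤ θ * g K
small-increment g θ D zero = inj₂ z≤n
small-increment g θ D (suc K) with small-increment g θ D K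
... | inj₁ (k , k<K , small) = inj₁ (k , m<n⇒m<1+n k<K , small)
... | inj₂ large with θ * g (suc K) ≤? θ * g K + D
...   | yes small = inj₁ (K , ≤-refl , small)
...   | no ¬small = inj₂ (begin
  suc D + K * suc D    ≤⟨ +-monoʳ-≤ (suc D) large ⟩
  suc D + θ * g K      ≡⟨ +-comm (suc D) _ ⟩
  θ * g K + suc D      ≡⟨ +-suc _ D ⟩
  suc (θ * g K + D)    ≤⟨ ≰⇒> ¬small ⟩
  θ * g (suc K)        ∎)
  where open ≤-Reasoning

-- Leaders and bounds on sums of `H`.

module Family {D q n N a : ℕ} .{{_ : NonZero D}} .{{_ : NonZero q}} (3≤N : 3 ≤ N)
  (μ : Fin q → Weighting D)
  (A : ∀ i → Fin n → Subset (Weighting.points (μ i)))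
  where

  private
    module μ i = Weighting (μ i)

    instance
      N≢0 : NonZero N
      N≢0 = >-nonZero (≤-trans (s≤s z≤n) 3≤N)

  Common : ∀ i → Subset n → Fin (μ.points i) → Set
  Common i S ω = ∀ x → x ∈ˢ S → ω ∈ˢ A i x

  common? : ∀ i S ω → Dec (Common i S ω)
  common? i S ω = all? λ x → (x ∈? S) →-dec (ω ∈? A i x)

  ρ ρᶜ : Fin q → Fin n → ℕ
  ρ i x = μ.∫ i λ ω → 𝟙 (ω ∈? A i x)
  ρᶜ i x = μ.∫ i λ ω → 𝟙 (¬? (ω ∈? A i x))

  ρ∩ : Fin q → Subset n → ℕ
  ρ∩ i S = μ.∫ i λ ω → 𝟙 (common? i S ω)

  ρ+ρᶜ : ∀ i x → ρ i x + ρᶜ i x ≡ D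
  ρ+ρᶜ i x = trans (sym (μ.+-hom i _ _)) (trans (μ.cong-≗ i λ ω → 𝟙-¬? (ω ∈? A i x)) (μ.∫-1 i))

  leader : Fin n → Fin q
  leader x = proj₁ (argmin λ i → ρ i x)

  H : Fin n → ℕ
  H x = ρ (leader x) x

  H≤ρ : ∀ i x → H x ≤ ρ i x
  H≤ρ i x = proj₂ (argmin λ i → ρ i x) i

  -- The number `N` stands for `1 / ε`: an inequality `N * s ≤ D` says that the measure `s / D` is
  -- at most ε. In this scaling (A1) says that the measures of the complements sum to at most
  -- `1 + 1 / N`.
  module _ (A1 : ∀ x → N * ∑ (λ i → ρᶜ i x) ≤ suc N * D) where

    -- The complements at `i` and at the leader together have measure at most `1 + 1 / N`, and the
    -- one at the leader has measure `1 - H x`.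
    ρᶜ-small : ∀ {i x} → i ≢ leader x → N * ρᶜ i x ≤ N * H x + D
    ρᶜ-small {i} {x} i≢ℓ = +-cancelˡ-≤ (N * ρᶜ ℓ x) _ _ (begin
      N * ρᶜ ℓ x + N * ρᶜ i x        ≡⟨ *-distribˡ-+ N (ρᶜ ℓ x) (ρᶜ i x) ⟨
      N * (ρᶜ ℓ x + ρᶜ i x)          ≤⟨ *-monoʳ-≤ N (two-terms≤∑ (λ j → ρᶜ j x) (i≢ℓ ∘ sym)) ⟩
      N * ∑ (λ j → ρᶜ j x)           ≤⟨ A1 x ⟩
      D + N * D                      ≡⟨ cong (λ d → D + N * d) (ρ+ρᶜ ℓ x) ⟨
      D + N * (H x + ρᶜ ℓ x)         ≡⟨ lemma D N (H x) (ρᶜ ℓ x) ⟩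
      N * ρᶜ ℓ x + (N * H x + D)     ∎)
      where
      open ≤-Reasoning
      ℓ = leader x
      lemma : ∀ d m h c → d + m * (h + c) ≡ m * c + (m * h + d)
      lemma = solve-∀

    -- Since `H x` is at most `ρ i x`, the bound `ρᶜ-small` gives that `ρ i x` is at least
    -- `(1 - 1 / N) / 2`, which is at least `1 / 3` for `N` at least 3.
    ρ-large : ∀ {i x} → i ≢ leader x → D ≤ 3 * ρ i x
    ρ-large {i} {x} i≢ℓ = *-cancelˡ-≤ (2 * N) {{m*n≢0 2 N}} (+-cancelʳ-≤ (N * D) _ _ (begin
      2 * N * D + N * D                    ≡⟨ lemma₁ N D ⟩
      3 * (N * D)                          ≡⟨ cong (λ d → 3 * (N * d)) (ρ+ρᶜ i x) ⟨
      3 * (N * (ρ i x + ρᶜ i x))           ≡⟨ lemma₂ N (ρ i x) (ρᶜ i x) ⟩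
      3 * (N * ρ i x + N * ρᶜ i x)         ≤⟨ *-monoʳ-≤ 3 (+-monoʳ-≤ (N * ρ i x) (ρᶜ-small i≢ℓ)) ⟩
      3 * (N * ρ i x + (N * H x + D))      ≤⟨ *-monoʳ-≤ 3 (+-monoʳ-≤ (N * ρ i x) (+-monoˡ-≤ D (*-monoʳ-≤ N (H≤ρ i x)))) ⟩
      3 * (N * ρ i x + (N * ρ i x + D))    ≡⟨ lemma₃ N (ρ i x) D ⟩
      2 * N * (3 * ρ i x) + 3 * D          ≤⟨ +-monoʳ-≤ (2 * N * (3 * ρ i x)) (*-monoˡ-≤ D 3≤N) ⟩
      2 * N * (3 * ρ i x) + N * D          ∎))
      where
      open ≤-Reasoning
      lemma₁ : ∀ m d → 2 * m * d + m * d ≡ 3 * (m * d)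
      lemma₁ = solve-∀
      lemma₂ : ∀ m r c → 3 * (m * (r + c)) ≡ 3 * (m * r + m * c)
      lemma₂ = solve-∀
      lemma₃ : ∀ m r d → 3 * (m * r + (m * r + d)) ≡ 2 * m * (3 * r) + 3 * d
      lemma₃ = solve-∀

    module _ (A2 : ∀ S → ∣ S ∣ ≡ a → ∃ λ i → N * ρ∩ i S ≤ D) where

      private
        crowded : Subset n → (∀ i → Fin (μ.points i)) → ℕ
        crowded S ω = 𝟙 (∣ S ∣ ≟ⁿ a) * ∏ λ i → 𝟙 (common? i S (ω i))

        everywhere : Fin n → (∀ i → Fin (μ.points i)) → ℕ
        everywhere x ω = ∏ λ i → 𝟙 (ω i ∈? A i x)

        -- Either at most `a` vertices of `Y` have all their events hit by `ω`, or some `a` of them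
        -- form a crowded set; then the second summand is at least `∣ Y ∣`, which bounds the sum
        -- trivially.
        few-or-crowded : ∀ Y ω →
          ∑∈ Y (λ x → everywhere x ω) ≤ a + ∣ Y ∣ * ∑⊆ Y λ S → crowded S ω
        few-or-crowded Y ω = ≤-trans ∑≤∣V∣ ∣V∣≤
          where
          In? : ∀ x → Dec (x ∈ˢ Y × ∀ i → ω i ∈ˢ A i x)
          In? x = (x ∈? Y) ×-dec all? λ i → ω i ∈? A i x

          V = select In?

          term : ∀ {x} → x ∈ˢ Y → everywhere x ω ≤ 𝟙 (x ∈? V)
          term {x} x∈Y with all? (λ i → ω i ∈? A i x)
          ... | yes all = ≤-reflexive (trans (∏-𝟙-yes (λ i → ω i ∈? A i x) all)
                            (sym (𝟙-yes (x ∈? V) (select⁺ In? (x∈Y , all)))))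
          ... | no ¬all with i , ∉A ← ¬∀⟶∃¬ _ _ (λ i → ω i ∈? A i x) ¬all =
            ≤-trans (≤-reflexive (∏-𝟙-no (λ i → ω i ∈? A i x) i ∉A)) z≤n

          ∑≤∣V∣ : ∑∈ Y (λ x → everywhere x ω) ≤ ∣ V ∣
          ∑≤∣V∣ = begin
            ∑∈ Y (λ x → everywhere x ω)   ≤⟨ ∑∈-mono Y term ⟩
            ∑∈ Y (λ x → 𝟙 (x ∈? V))       ≤⟨ ∑-mono (λ x → *-monoˡ-≤ (𝟙 (x ∈? V)) (𝟙≤1 (x ∈? Y))) ⟩
            ∑ (λ x → 1 * 𝟙 (x ∈? V))      ≡⟨ sum-cong-≗ (λ x → *-identityˡ (𝟙 (x ∈? V))) ⟩
            ∑ (λ x → 𝟙 (x ∈? V))          ≡⟨ ∣S∣≡∑ V ⟨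
            ∣ V ∣                         ∎
            where open ≤-Reasoning

          V⊆Y : V ⊆ Y
          V⊆Y x∈V = proj₁ (select⁻ In? x∈V)

          ∣V∣≤ : ∣ V ∣ ≤ a + ∣ Y ∣ * ∑⊆ Y λ S → crowded S ω
          ∣V∣≤ with ∣ V ∣ ≤? a
          ... | yes ∣V∣≤a = ≤-trans ∣V∣≤a (m≤m+n a _)
          ... | no ∣V∣≰a with S , S⊆V , ∣S∣≡a ← shrink V (<⇒≤ (≰⇒> ∣V∣≰a)) = begin
            ∣ V ∣                                   ≤⟨ p⊆q⇒∣p∣≤∣q∣ V⊆Y ⟩
            ∣ Y ∣                                   ≡⟨ *-identityʳ ∣ Y ∣ ⟨
            ∣ Y ∣ * 1                               ≡⟨ cong (∣ Y ∣ *_) (cong₂ _*_ (𝟙-yes (∣ S ∣ ≟ⁿ a) ∣S∣≡a)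
                                                         (∏-𝟙-yes (λ i → common? i S (ω i)) λ i x x∈S → proj₂ (select⁻ In? (S⊆V x∈S)) i)) ⟨
            ∣ Y ∣ * crowded S ω                     ≤⟨ *-monoʳ-≤ ∣ Y ∣ (term≤∑⊆ (λ S → crowded S ω) (V⊆Y ∘ S⊆V)) ⟩
            ∣ Y ∣ * ∑⊆ Y (λ S → crowded S ω)        ≤⟨ m≤n+m _ a ⟩
            a + ∣ Y ∣ * ∑⊆ Y (λ S → crowded S ω)    ∎
            where open ≤-Reasoning

        𝔼 : ((∀ i → Fin (μ.points i)) → ℕ) → ℕ
        𝔼 = ⨂ μ.∫

        𝔼-linear : Linear 𝔼
        𝔼-linear = ⨂-linear μ.∫-linear

        𝔼-1 : 𝔼 (const 1) ≤ D ^ q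
        𝔼-1 = begin
          -- The constant 1 is written as a product of `q` factors 1, to which `⨂-∏` applies.
          𝔼 (const 1)                              ≡⟨ Linear.cong-≗ 𝔼-linear (λ ω → sym (∏-𝟙-yes {q} (λ _ → yes refl) λ _ → refl {x = D})) ⟩
          𝔼 (λ ω → ∏ {q} λ i → 1)              ≡⟨ ⨂-∏ μ.∫-linear (λ _ _ → 1) ⟩
          ∏ {q} (λ i → μ.∫ i (const 1))        ≤⟨ ∏-^ {D = D} (λ i → μ.∫ i (const 1)) (≤-reflexive ∘ μ.∫-1) ⟩
          D ^ q                                ∎
          where open ≤-Reasoning

        -- The coordinates are independent; (A2) makes one factor at most `D / N`, and the others
        -- are at most `D`.
        crowded-rare : ∀ S → N * 𝔼 (crowded S) ≤ D ^ q
        crowded-rare S = begin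
          N * 𝔼 (crowded S)                                       ≡⟨ cong (N *_) (Linear.*-hom 𝔼-linear (𝟙 (∣ S ∣ ≟ⁿ a)) λ ω → ∏ λ i → 𝟙 (common? i S (ω i))) ⟩
          N * (𝟙 (∣ S ∣ ≟ⁿ a) * 𝔼 λ ω → ∏ λ i → 𝟙 (common? i S (ω i)))
            ≡⟨ cong (λ e → N * (𝟙 (∣ S ∣ ≟ⁿ a) * e)) (⨂-∏ μ.∫-linear λ i ω → 𝟙 (common? i S ω)) ⟩
          N * (𝟙 (∣ S ∣ ≟ⁿ a) * ∏ λ i → ρ∩ i S)                    ≤⟨ lemma (∣ S ∣ ≟ⁿ a) ⟩
          D ^ q                                               ∎
          where
          open ≤-Reasoning
          lemma : (d : Dec (∣ S ∣ ≡ a)) → N * (𝟙 d * ∏ λ i → ρ∩ i S) ≤ D ^ q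
          lemma (yes ∣S∣≡a) with i , small ← A2 S ∣S∣≡a =
            subst (λ e → N * e ≤ D ^ q) (sym (*-identityˡ (∏ λ i → ρ∩ i S)))
              (∏-small N (λ i → ρ∩ i S) (λ i → μ.∫-≤1 i λ ω → 𝟙≤1 (common? i S ω)) i small)
          lemma (no _) = ≤-trans (≤-reflexive (*-zeroʳ N)) z≤n

        -- The left side is the expectation of the sum in `few-or-crowded`. The crowded sets
        -- contribute at most `∣ Y ∣ * 2 ^ ∣ Y ∣ / N`, hence at most 1.
        ∑∏-bound : ∀ Y → ∣ Y ∣ * 2 ^ ∣ Y ∣ ≤ N → ∑∈ Y (λ x → ∏ λ i → ρ i x) ≤ suc a * D ^ q
        ∑∏-bound Y small = *-cancelˡ-≤ N (begin
          N * ∑∈ Y (λ x → ∏ λ i → ρ i x)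
            ≡⟨ cong (N *_) (sum-cong-≗ λ x → cong (𝟙 (x ∈? Y) *_) (⨂-∏ μ.∫-linear λ i ω → 𝟙 (ω ∈? A i x))) ⟨
          N * ∑∈ Y (λ x → 𝔼 (everywhere x))
            ≡⟨ cong (N *_) (∑∈-hom 𝔼-linear Y everywhere) ⟨
          N * 𝔼 (λ ω → ∑∈ Y λ x → everywhere x ω)
            ≤⟨ *-monoʳ-≤ N (Linear.mono 𝔼-linear (few-or-crowded Y)) ⟩
          N * 𝔼 (λ ω → a + ∣ Y ∣ * ∑⊆ Y λ S → crowded S ω)
            ≡⟨ cong (N *_) (trans (Linear.+-hom 𝔼-linear (const a) λ ω → ∣ Y ∣ * ∑⊆ Y λ S → crowded S ω)
                 (cong₂ _+_ (Linear.const-hom 𝔼-linear a) (Linear.*-hom 𝔼-linear ∣ Y ∣ λ ω → ∑⊆ Y λ S → crowded S ω))) ⟩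
          N * (a * 𝔼 (const 1) + ∣ Y ∣ * 𝔼 λ ω → ∑⊆ Y λ S → crowded S ω)
            ≡⟨ lemma₁ N a (𝔼 (const 1)) ∣ Y ∣ _ ⟩
          N * (a * 𝔼 (const 1)) + ∣ Y ∣ * (N * 𝔼 λ ω → ∑⊆ Y λ S → crowded S ω)
            ≤⟨ +-mono-≤ (*-monoʳ-≤ N (*-monoʳ-≤ a 𝔼-1)) (*-monoʳ-≤ ∣ Y ∣ (∑⊆-bound N 𝔼-linear Y crowded crowded-rare)) ⟩
          N * (a * D ^ q) + ∣ Y ∣ * (2 ^ ∣ Y ∣ * D ^ q)
            ≡⟨ cong (N * (a * D ^ q) +_) (*-assoc ∣ Y ∣ _ _) ⟨
          N * (a * D ^ q) + ∣ Y ∣ * 2 ^ ∣ Y ∣ * D ^ q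
            ≤⟨ +-monoʳ-≤ (N * (a * D ^ q)) (*-monoˡ-≤ (D ^ q) small) ⟩
          N * (a * D ^ q) + N * D ^ q
            ≡⟨ lemma₂ N a (D ^ q) ⟩
          N * (suc a * D ^ q) ∎)
          where
          open ≤-Reasoning
          lemma₁ : ∀ m b e y s → m * (b * e + y * s) ≡ m * (b * e) + y * (m * s)
          lemma₁ = solve-∀
          lemma₂ : ∀ m b e → m * (b * e) + m * e ≡ m * (suc b * e)
          lemma₂ = solve-∀

      κ : ℕ
      κ = 3 ^ q * suc a

      -- All factors of `∏ λ i → ρ i x` except the leader's are at least `D / 3`, so `∏-large`
      -- compares `H x` with this product.
      ∑H-bound : ∀ Y → ∣ Y ∣ * 2 ^ ∣ Y ∣ ≤ N → ∑∈ Y H ≤ κ * D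
      ∑H-bound Y small = *-cancelˡ-≤ (D ^ q) {{m^n≢0 D q}} (begin
        D ^ q * ∑∈ Y H                        ≡⟨ ∑∈-* Y (D ^ q) H ⟨
        ∑∈ Y (λ x → D ^ q * H x)              ≤⟨ ∑∈-mono Y (λ {x} _ → H-bound x) ⟩
        ∑∈ Y (λ x → 3 ^ q * D * ∏ λ i → ρ i x)    ≡⟨ ∑∈-* Y (3 ^ q * D) (λ x → ∏ λ i → ρ i x) ⟩
        3 ^ q * D * ∑∈ Y (λ x → ∏ λ i → ρ i x)    ≤⟨ *-monoʳ-≤ (3 ^ q * D) (∑∏-bound Y small) ⟩
        3 ^ q * D * (suc a * D ^ q)               ≡⟨ lemma (3 ^ q) (suc a) D (D ^ q) ⟩
        D ^ q * (κ * D)                           ∎)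
        where
        open ≤-Reasoning
        H-bound : ∀ x → D ^ q * H x ≤ 3 ^ q * D * ∏ λ i → ρ i x
        H-bound x = begin
          D ^ q * H x                        ≡⟨ *-comm (D ^ q) (H x) ⟩
          H x * D ^ q                        ≤⟨ ∏-large (λ i → ρ i x) (leader x) (λ j → ρ-large) ⟩
          3 ^ q * (D * ∏ λ i → ρ i x)        ≡⟨ *-assoc (3 ^ q) D _ ⟨
          3 ^ q * D * ∏ (λ i → ρ i x)        ∎
        lemma : ∀ t b d e → t * d * (b * e) ≡ e * (t * b * d)
        lemma = solve-∀

      level : ℕ → Subset n
      level c = select λ x → D <? c * H x

      -- Otherwise `suc (κ * c)` of its vertices, each with `H` above `1 / c`, would violate
      -- `∑H-bound`. Passing to a subset of this exact size keeps the requirement on `N` independent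
      -- of `n`.
      ∣level∣ : ∀ c → suc (κ * c) * 2 ^ suc (κ * c) ≤ N → ∣ level c ∣ ≤ κ * c
      ∣level∣ c small with ∣ level c ∣ ≤? κ * c
      ... | yes ≤κc = ≤κc
      ... | no ≰κc with Y , Y⊆ , ∣Y∣ ← shrink (level c) (≰⇒> ≰κc) =
        contradiction (*-cancelʳ-≤ (suc (κ * c)) (κ * c) D (begin
          suc (κ * c) * D          ≡⟨ cong (_* D) ∣Y∣ ⟨
          ∣ Y ∣ * D                ≡⟨ ∑∈-const Y D ⟨
          ∑∈ Y (const D)           ≤⟨ ∑∈-mono Y (λ x∈Y → <⇒≤ (select⁻ (λ x → D <? c * H x) (Y⊆ x∈Y))) ⟩
          ∑∈ Y (λ x → c * H x)     ≡⟨ ∑∈-* Y c H ⟩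
          c * ∑∈ Y H               ≤⟨ *-monoʳ-≤ c (∑H-bound Y (subst (λ m → m * 2 ^ m ≤ N) (sym ∣Y∣) small)) ⟩
          c * (κ * D)              ≡⟨ lemma c κ D ⟩
          κ * c * D                ∎)) (<⇒≱ ≤-refl)
        where
        open ≤-Reasoning
        lemma : ∀ c k d → c * (k * d) ≡ k * c * d
        lemma = solve-∀

      -- Choice of one sample point in each space.

      module Choice {F F′ : Subset n} (F⊆F′ : F ⊆ F′) {p r c : ℕ} .{{_ : NonZero r}} where

        private
          m = ∣ F ∣
          θ = 8 * (q * a)

          instance
            2^m≢0 : NonZero (2 ^ m)
            2^m≢0 = m^n≢0 2 m

          miss : ∀ i → Fin n → Fin (μ.points i) → ℕ
          miss i x ω = 𝟙 (¬? (ω ∈? A i x))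

        band? : ∀ x → Dec (x ∈ˢ F′ × x ∉ F)
        band? x = (x ∈? F′) ×-dec ¬? (x ∈? F)

        B : Subset n
        B = select band?

        -- A set is rare below measure `1 / p`, where `p` beats the number `2 ^ m` of subsets of
        -- `F`. Vertices outside `F′` have `H` at most `1 / c`, where `c` beats `p * r`. The
        -- conditions on `N` make the terms in `1 / N` negligible.
        module Sampled
          (8m≤N : 8 * m ≤ N)
          (θ∣F′∣≤N : θ * ∣ F′ ∣ ≤ N)
          (null≤N : 8 * (q * suc m) * 2 ^ m ≤ N)
          (light : θ * ∑∈ B H ≤ D)
          (θ2^m≤p : θ * 2 ^ m ≤ p)
          (2pr≤c : 2 * (p * r) ≤ c)
          (2p⟨1+r⟩≤N : 2 * (p * suc r) ≤ N)
          (outer : ∀ {x} → x ∉ F′ → c * H x ≤ D)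
          where

          private
            strays? : ∀ i x → Dec (x ∈ˢ B × i ≢ leader x)
            strays? i x = (x ∈? B) ×-dec ¬? (i ≟ leader x)

            strays : Fin q → Subset n
            strays i = select (strays? i)

            Good : ∀ i → Subset n → Fin (μ.points i) → Set
            Good i T ω = Common i (strays i) ω × Common i T ω

            good? : ∀ i T ω → Dec (Good i T ω)
            good? i T ω = common? i (strays i) ω ×-dec common? i T ω

            rare? : ∀ i T → Dec (p * μ.∫ i (𝟙 ∘ good? i T) ≤ D)
            rare? i T = p * μ.∫ i (𝟙 ∘ good? i T) ≤? D

            null? : ∀ i S → Dec (N * ρ∩ i S ≤ D)
            null? i S = N * ρ∩ i S ≤? D

            -- A point that strays or is rare costs at least a, a null point more than m.
            missed stray rare null penalty : ∀ i → Fin (μ.points i) → ℕ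
            missed i ω = ∑∈ F λ x → miss i x ω
            stray i ω = ∑∈ (strays i) λ x → miss i x ω
            rare i ω = ∑⊆ F λ T → 𝟙 (rare? i T) * 𝟙 (good? i T ω)
            null i ω = ∑⊆ F λ S → 𝟙 (null? i S) * 𝟙 (common? i S ω)
            penalty i ω = a * stray i ω + (a * rare i ω + suc m * null i ω)

            -- By (A1) each vertex of `F` contributes at most `1 + 1 / N`; `8 * m ≤ N` keeps the
            -- total excess below or equal to `1 / 8`.
            ∑∫missed : 8 * ∑ (λ i → μ.∫ i (missed i)) ≤ 8 * (m * D) + D
            ∑∫missed = *-cancelˡ-≤ N (begin
              N * (8 * ∑ λ i → μ.∫ i (missed i))
                ≡⟨ cong (λ s → N * (8 * s)) (sum-cong-≗ λ i → ∑∈-hom (μ.∫-linear i) F (miss i)) ⟩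
              N * (8 * ∑ λ i → ∑∈ F (ρᶜ i))
                ≡⟨ cong (λ s → N * (8 * s)) (∑∈-hom ∑-linear F λ x i → ρᶜ i x) ⟩
              N * (8 * ∑∈ F λ x → ∑ λ i → ρᶜ i x)
                ≡⟨ x∙yz≈y∙xz N 8 _ ⟩
              8 * (N * ∑∈ F λ x → ∑ λ i → ρᶜ i x)
                ≤⟨ *-monoʳ-≤ 8 (∑∈-bound F (λ x → ∑ λ i → ρᶜ i x) {N} (λ {x} _ → A1 x)) ⟩
              8 * (m * (suc N * D))
                ≡⟨ lemma₂ m N D ⟩
              N * (8 * (m * D)) + 8 * m * D
                ≤⟨ +-monoʳ-≤ (N * (8 * (m * D))) (*-monoˡ-≤ D 8m≤N) ⟩
              N * (8 * (m * D)) + N * D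
                ≡⟨ *-distribˡ-+ N (8 * (m * D)) D ⟨
              N * (8 * (m * D) + D) ∎)
              where
              open ≤-Reasoning
              lemma₂ : ∀ x y d → 8 * (x * (suc y * d)) ≡ y * (8 * (x * d)) + 8 * x * d
              lemma₂ = solve-∀

            -- A coordinate that does not lead `x` misses it with probability at most `H x + 1 / N`.
            -- The lightness of `B` pays for the terms `H x`, and the size of `N` for the rest; each
            -- part is at most `1 / θ`.
            ∫stray : ∀ i → θ * μ.∫ i (stray i) ≤ D + D
            ∫stray i = *-cancelˡ-≤ N (begin
              N * (θ * μ.∫ i (stray i))
                ≡⟨ x∙yz≈y∙xz N θ (μ.∫ i (stray i)) ⟩
              θ * (N * μ.∫ i (stray i))
                ≡⟨ cong (λ s → θ * (N * s)) (∑∈-hom (μ.∫-linear i) (strays i) (miss i)) ⟩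
              θ * (N * ∑∈ (strays i) (ρᶜ i))
                ≡⟨ cong (θ *_) (∑∈-* (strays i) N (ρᶜ i)) ⟨
              θ * ∑∈ (strays i) (λ x → N * ρᶜ i x)
                ≤⟨ *-monoʳ-≤ θ (∑∈-mono (strays i) λ x∈ → ρᶜ-small (proj₂ (select⁻ (strays? i) x∈))) ⟩
              θ * ∑∈ (strays i) (λ x → N * H x + D)
                ≤⟨ *-monoʳ-≤ θ (∑∈-⊆ {S = strays i} {B} _ (proj₁ ∘ select⁻ (strays? i))) ⟩
              θ * ∑∈ B (λ x → N * H x + D)
                ≡⟨ cong (θ *_) (trans (∑∈-+ B (λ x → N * H x) (const D)) (cong₂ _+_ (∑∈-* B N H) (∑∈-const B D))) ⟩
              θ * (N * ∑∈ B H + ∣ B ∣ * D)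
                ≤⟨ *-monoʳ-≤ θ (+-monoʳ-≤ (N * ∑∈ B H) (*-monoˡ-≤ D (p⊆q⇒∣p∣≤∣q∣ {p = B} {F′} (proj₁ ∘ select⁻ band?)))) ⟩
              θ * (N * ∑∈ B H + ∣ F′ ∣ * D)
                ≡⟨ lemma₂ θ N (∑∈ B H) ∣ F′ ∣ D ⟩
              N * (θ * ∑∈ B H) + θ * ∣ F′ ∣ * D
                ≤⟨ +-mono-≤ (*-monoʳ-≤ N light) (*-monoˡ-≤ D θ∣F′∣≤N) ⟩
              N * D + N * D
                ≡⟨ *-distribˡ-+ N D D ⟨
              N * (D + D) ∎)
              where
              open ≤-Reasoning
              lemma₂ : ∀ t x h f d → t * (x * h + f * d) ≡ x * (t * h) + t * f * d
              lemma₂ = solve-∀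

            indicated : ∀ i k {P : Set} (e : Dec P) (f : Fin (μ.points i) → ℕ) → (P → k * μ.∫ i f ≤ D) →
                        k * μ.∫ i (λ ω → 𝟙 e * f ω) ≤ D
            indicated i k (yes p) f small =
              ≤-trans (≤-reflexive (cong (k *_) (μ.cong-≗ i (*-identityˡ ∘ f)))) (small p)
            indicated i k (no _) f small =
              ≤-trans (≤-reflexive (trans (cong (k *_) (μ.∫-const i 0)) (*-zeroʳ k))) z≤n

            -- A union bound over the `2 ^ m` subsets of `F`; those that count have measure at most
            -- `1 / p`.
            ∫rare : ∀ i → θ * μ.∫ i (rare i) ≤ D
            ∫rare i = *-cancelˡ-≤ (2 ^ m) (begin
              2 ^ m * (θ * μ.∫ i (rare i))    ≡⟨ lemma (2 ^ m) θ (μ.∫ i (rare i)) ⟩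
              θ * 2 ^ m * μ.∫ i (rare i)      ≤⟨ *-monoˡ-≤ (μ.∫ i (rare i)) θ2^m≤p ⟩
              p * μ.∫ i (rare i)              ≤⟨ ∑⊆-bound p (μ.∫-linear i) F _ (λ T → indicated i p (rare? i T) (𝟙 ∘ good? i T) id) ⟩
              2 ^ m * D                       ∎)
              where
              open ≤-Reasoning
              lemma : ∀ x t s → x * (t * s) ≡ t * x * s
              lemma = solve-∀

            ∫null : ∀ i → 8 * (q * suc m) * μ.∫ i (null i) ≤ D
            ∫null i = *-cancelˡ-≤ N (begin
              N * (8 * (q * suc m) * μ.∫ i (null i))    ≡⟨ x∙yz≈y∙xz N (8 * (q * suc m)) (μ.∫ i (null i)) ⟩
              8 * (q * suc m) * (N * μ.∫ i (null i))    ≤⟨ *-monoʳ-≤ (8 * (q * suc m))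
                                                                 (∑⊆-bound N (μ.∫-linear i) F _ λ S → indicated i N (null? i S) (𝟙 ∘ common? i S) id) ⟩
              8 * (q * suc m) * (2 ^ m * D)             ≡⟨ *-assoc (8 * (q * suc m)) (2 ^ m) D ⟨
              8 * (q * suc m) * 2 ^ m * D               ≤⟨ *-monoˡ-≤ D null≤N ⟩
              N * D                                         ∎)
              where
              open ≤-Reasoning

            ∫penalty : ∀ i → q * (8 * μ.∫ i (penalty i)) ≤ 4 * D
            ∫penalty i = begin
              q * (8 * μ.∫ i (penalty i))
                ≡⟨ cong (λ s → q * (8 * s)) expand ⟩
              q * (8 * (a * ∫s + (a * ∫r + suc m * ∫n)))
                ≡⟨ lemma (q) a (suc m) ∫s ∫r ∫n ⟩
              θ * ∫s + (θ * ∫r + 8 * (q * suc m) * ∫n)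
                ≤⟨ +-mono-≤ (∫stray i) (+-mono-≤ (∫rare i) (∫null i)) ⟩
              (D + D) + (D + D)
                ≡⟨ lemma′ D ⟩
              4 * D ∎
              where
              open ≤-Reasoning
              ∫s = μ.∫ i (stray i)
              ∫r = μ.∫ i (rare i)
              ∫n = μ.∫ i (null i)
              expand : μ.∫ i (penalty i) ≡ a * ∫s + (a * ∫r + suc m * ∫n)
              expand = trans (μ.+-hom i _ _) (cong₂ _+_ (μ.*-hom i a (stray i))
                (trans (μ.+-hom i _ _) (cong₂ _+_ (μ.*-hom i a (rare i)) (μ.*-hom i (suc m) (null i)))))
              lemma : ∀ k b l x y z → k * (8 * (b * x + (b * y + l * z))) ≡
                      8 * (k * b) * x + (8 * (k * b) * y + 8 * (k * l) * z)
              lemma = solve-∀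
              lemma′ : ∀ d → (d + d) + (d + d) ≡ 4 * d
              lemma′ = solve-∀

            ∑∫penalty : 8 * ∑ (λ i → μ.∫ i (penalty i)) ≤ 4 * D
            ∑∫penalty = *-cancelˡ-≤ q (begin
              q * (8 * ∑ λ i → μ.∫ i (penalty i))        ≡⟨ cong (q *_) (*-distribˡ-sum 8 λ i → μ.∫ i (penalty i)) ⟩
              q * ∑ (λ i → 8 * μ.∫ i (penalty i))        ≡⟨ *-distribˡ-sum (q) (λ i → 8 * μ.∫ i (penalty i)) ⟩
              ∑ (λ i → q * (8 * μ.∫ i (penalty i)))      ≤⟨ ∑-mono ∫penalty ⟩
              ∑ {q} (λ _ → 4 * D)                        ≡⟨ ∑-const (q) (4 * D) ⟩
              q * (4 * D)                                ∎)
              where open ≤-Reasoning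

            -- The expected total cost is at most `m + 1/8 + 4/8`, so an integral cost not above the
            -- mean is at most `m`. As the cost is a sum of functions of single coordinates,
            -- `average` is applied to each coordinate separately.
            sample : ∃ λ (ω : ∀ i → Fin (μ.points i)) →
                     ∑ (λ i → missed i (ω i)) + ∑ (λ i → penalty i (ω i)) ≤ m
            sample = ω , s≤s⁻¹ (*-cancelˡ-< (8 * D) _ _ (begin-strict
              8 * D * (∑ (λ i → missed i (ω i)) + ∑ (λ i → penalty i (ω i)))
                ≡⟨ cong (8 * D *_) (∑-distrib-+ (λ i → missed i (ω i)) λ i → penalty i (ω i)) ⟨
              8 * D * ∑ (λ i → φ i (ω i))
                ≡⟨ *-assoc 8 D _ ⟩
              8 * (D * ∑ λ i → φ i (ω i))
                ≡⟨ cong (8 *_) (*-distribˡ-sum D λ i → φ i (ω i)) ⟩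
              8 * ∑ (λ i → D * φ i (ω i))
                ≤⟨ *-monoʳ-≤ 8 (∑-mono λ i → proj₂ (average (μ i) (φ i))) ⟩
              8 * ∑ (λ i → μ.∫ i (φ i))
                ≡⟨ cong (8 *_) (trans (sum-cong-≗ λ i → μ.+-hom i (missed i) (penalty i))
                     (∑-distrib-+ (λ i → μ.∫ i (missed i)) λ i → μ.∫ i (penalty i))) ⟩
              8 * (∑ (λ i → μ.∫ i (missed i)) + ∑ (λ i → μ.∫ i (penalty i)))
                ≡⟨ *-distribˡ-+ 8 (∑ λ i → μ.∫ i (missed i)) _ ⟩
              8 * ∑ (λ i → μ.∫ i (missed i)) + 8 * ∑ (λ i → μ.∫ i (penalty i))
                ≤⟨ +-mono-≤ ∑∫missed ∑∫penalty ⟩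
              (8 * (m * D) + D) + 4 * D
                ≡⟨ lemma₁ m D ⟩
              8 * (m * D) + 5 * D
                <⟨ +-monoʳ-< (8 * (m * D)) (*-monoˡ-< D (m≤m+n 6 2)) ⟩
              8 * (m * D) + 8 * D
                ≡⟨ lemma₂ m D ⟩
              8 * D * suc m ∎))
              where
              open ≤-Reasoning
              φ : ∀ i → Fin (μ.points i) → ℕ
              φ i ω = missed i ω + penalty i ω
              ω : ∀ i → Fin (μ.points i)
              ω i = proj₁ (average (μ i) (φ i))
              lemma₁ : ∀ x d → (8 * (x * d) + d) + 4 * d ≡ 8 * (x * d) + 5 * d
              lemma₁ = solve-∀
              lemma₂ : ∀ x d → 8 * (x * d) + 8 * d ≡ 8 * d * suc x
              lemma₂ = solve-∀

          ω : ∀ i → Fin (μ.points i)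
          ω = proj₁ sample

          private
            ∈A? : ∀ x i → Dec (ω i ∈ˢ A i x)
            ∈A? x i = ω i ∈? A i x

            everywhere? : ∀ x → Dec (x ∈ˢ F × ∀ i → ω i ∈ˢ A i x)
            everywhere? x = (x ∈? F) ×-dec all? (∈A? x)

            V = select everywhere?

            pays : ∀ i → penalty i (ω i) ≤ m
            pays i = ≤-trans (term≤∑ (λ i → penalty i (ω i)) i) (≤-trans (m≤n+m _ _) (proj₂ sample))

            -- By (A2) an `a`-element subset of `V` would be null in some coordinate, and the chosen
            -- point there would cost `suc m`, above the budget `m`.
            ∣V∣<a : ∣ V ∣ < a
            ∣V∣<a with a ≤? ∣ V ∣
            ... | no a≰∣V∣ = ≰⇒> a≰∣V∣
            ... | yes a≤∣V∣ with S , S⊆V , ∣S∣≡a ← shrink V a≤∣V∣ with i , isNull ← A2 S ∣S∣≡a =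
              contradiction (begin
                suc m                     ≡⟨ *-identityʳ (suc m) ⟨
                suc m * 1                 ≤⟨ *-monoʳ-≤ (suc m) 1≤null ⟩
                suc m * null i (ω i)      ≤⟨ ≤-trans (m≤n+m _ (a * rare i (ω i))) (m≤n+m _ (a * stray i (ω i))) ⟩
                penalty i (ω i)           ≤⟨ pays i ⟩
                m                         ∎) (<⇒≱ ≤-refl)
              where
              open ≤-Reasoning
              1≤null : 1 ≤ null i (ω i)
              1≤null = begin
                1                                          ≡⟨ cong₂ _*_ (𝟙-yes (null? i S) isNull)
                  (𝟙-yes (common? i S (ω i)) λ x x∈S → proj₂ (select⁻ everywhere? (S⊆V x∈S)) i) ⟨
                𝟙 (null? i S) * 𝟙 (common? i S (ω i))      ≤⟨ term≤∑⊆ (λ S → 𝟙 (null? i S) * 𝟙 (common? i S (ω i)))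
                                                                (proj₁ ∘ select⁻ everywhere? ∘ S⊆V) ⟩
                null i (ω i)                               ∎

            AllBut : Fin n → Fin q → Set
            AllBut x i = ∀ j → j ≢ i → ω j ∈ˢ A j x

            allBut? : ∀ x → Dec (∃ (AllBut x))
            allBut? x = any? λ i → all? λ j → ¬? (j ≟ i) →-dec ∈A? x j

            bad? : ∀ x → Dec (x ∈ˢ F × ¬ ∃ (AllBut x))
            bad? x = (x ∈? F) ×-dec ¬? (allBut? x)

          Z : Subset n
          Z = select bad?

          private
            misses : Fin n → ℕ
            misses x = ∑ λ i → miss i x (ω i)

            miss-yes : ∀ {i x} → ω i ∉ A i x → 1 ≤ miss i x (ω i)
            miss-yes {i} {x} ∉A = ≤-reflexive (sym (𝟙-yes (¬? (∈A? x i)) ∉A))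

            -- A vertex of `F` missed nowhere lies in `V`, any other is missed at least once, and
            -- one in `Z` at least twice.
            one-or-two-misses : ∀ {x} → x ∈ˢ F → 1 + 𝟙 (x ∈? Z) ≤ misses x + 𝟙 (x ∈? V)
            one-or-two-misses {x} x∈F with all? (∈A? x)
            ... | yes all = begin
              -- Any coordinate would serve as the witness here; `leader x` is merely one at hand.
              1 + 𝟙 (x ∈? Z)           ≡⟨ cong suc (𝟙-no (x ∈? Z) λ x∈Z → proj₂ (select⁻ bad? x∈Z) (leader x , λ j _ → all j)) ⟩
              1                        ≡⟨ 𝟙-yes (x ∈? V) (select⁺ everywhere? (x∈F , all)) ⟨
              𝟙 (x ∈? V)               ≤⟨ m≤n+m _ (misses x) ⟩
              misses x + 𝟙 (x ∈? V)    ∎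
              where open ≤-Reasoning
            ... | no ¬all with i , ∉Aᵢ ← ¬∀⟶∃¬ _ _ (∈A? x) ¬all with all? (λ j → ¬? (j ≟ i) →-dec ∈A? x j)
            ...   | yes allBut = begin
              1 + 𝟙 (x ∈? Z)           ≡⟨ cong suc (𝟙-no (x ∈? Z) λ x∈Z → proj₂ (select⁻ bad? x∈Z) (i , allBut)) ⟩
              1                        ≤⟨ miss-yes ∉Aᵢ ⟩
              miss i x (ω i)           ≤⟨ term≤∑ (λ i → miss i x (ω i)) i ⟩
              misses x                 ≤⟨ m≤m+n _ _ ⟩
              misses x + 𝟙 (x ∈? V)    ∎
              where open ≤-Reasoning
            ...   | no ¬allBut with j , ¬imp ← ¬∀⟶∃¬ _ _ (λ j → ¬? (j ≟ i) →-dec ∈A? x j) ¬allBut = begin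
              1 + 𝟙 (x ∈? Z)                     ≤⟨ +-monoʳ-≤ 1 (𝟙≤1 (x ∈? Z)) ⟩
              1 + 1                              ≤⟨ +-mono-≤ (miss-yes ∉Aᵢ) (miss-yes λ ∈Aⱼ → ¬imp λ _ → ∈Aⱼ) ⟩
              miss i x (ω i) + miss j x (ω j)    ≤⟨ two-terms≤∑ (λ i → miss i x (ω i)) (λ { refl → ¬imp (contradiction refl) }) ⟩
              misses x                           ≤⟨ m≤m+n _ _ ⟩
              misses x + 𝟙 (x ∈? V)              ∎
              where open ≤-Reasoning

            ∑penalty : ℕ
            ∑penalty = ∑ λ i → penalty i (ω i)

            -- Summing `one-or-two-misses` over `F` bounds `m + ∣ Z ∣` by the misses plus `∣ V ∣`,
            -- while `sample` bounds the misses by `m - ∑penalty`.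
            ∣Z∣+∑penalty≤∣V∣ : ∣ Z ∣ + ∑penalty ≤ ∣ V ∣
            ∣Z∣+∑penalty≤∣V∣ = +-cancelˡ-≤ (m + ∑missed) _ _ (begin
              (m + ∑missed) + (∣ Z ∣ + ∑penalty)
                ≡⟨ lemma m ∑missed ∣ Z ∣ ∑penalty ⟩
              (m + ∣ Z ∣) + (∑missed + ∑penalty)
                ≤⟨ +-mono-≤ m+∣Z∣≤ (proj₂ sample) ⟩
              (∑missed + ∣ V ∣) + m
                ≡⟨ lemma′ ∑missed ∣ V ∣ m ⟩
              (m + ∑missed) + ∣ V ∣ ∎)
              where
              open ≤-Reasoning
              ∑missed = ∑ λ i → missed i (ω i)
              lemma : ∀ x y z w → (x + y) + (z + w) ≡ (x + z) + (y + w)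
              lemma = solve-∀
              lemma′ : ∀ x y z → (x + y) + z ≡ (z + x) + y
              lemma′ = solve-∀
              m+∣Z∣≤ : m + ∣ Z ∣ ≤ ∑missed + ∣ V ∣
              m+∣Z∣≤ = begin
                m + ∣ Z ∣                                     ≡⟨ cong₂ _+_ (sym (trans (∑∈-const F 1) (*-identityʳ m)))
                                                                   (sym (∑∈-𝟙 {S = Z} {F} (proj₁ ∘ select⁻ bad?))) ⟩
                ∑∈ F (const 1) + ∑∈ F (λ x → 𝟙 (x ∈? Z))      ≡⟨ ∑∈-+ F (const 1) (λ x → 𝟙 (x ∈? Z)) ⟨
                ∑∈ F (λ x → 1 + 𝟙 (x ∈? Z))                   ≤⟨ ∑∈-mono F one-or-two-misses ⟩
                ∑∈ F (λ x → misses x + 𝟙 (x ∈? V))            ≡⟨ ∑∈-+ F misses (λ x → 𝟙 (x ∈? V)) ⟩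
                ∑∈ F misses + ∑∈ F (λ x → 𝟙 (x ∈? V))         ≡⟨ cong₂ _+_ (sym (∑∈-hom ∑-linear F λ x i → miss i x (ω i)))
                                                                   (∑∈-𝟙 {S = V} {F} (proj₁ ∘ select⁻ everywhere?)) ⟩
                ∑missed + ∣ V ∣                               ∎

          ∣Z∣≤a-1 : ∣ Z ∣ ≤ a ∸ 1
          ∣Z∣≤a-1 = <⇒≤pred (≤-<-trans (≤-trans (m≤m+n _ ∑penalty) ∣Z∣+∑penalty≤∣V∣) ∣V∣<a)

          private
            -- The total penalty is at most `∣ V ∣`. Since one stray or rare event would already
            -- cost `a`, neither occurs at `ω`.
            penalty<a : ∀ i → penalty i (ω i) < a
            penalty<a i = ≤-<-trans
              (≤-trans (term≤∑ (λ i → penalty i (ω i)) i) (≤-trans (m≤n+m _ ∣ Z ∣) ∣Z∣+∑penalty≤∣V∣)) ∣V∣<a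

            stray≡0 : ∀ i → stray i (ω i) ≡ 0
            stray≡0 i = *-small⇒≡0 _ (≤-<-trans (m≤m+n _ _) (penalty<a i))

            rare≡0 : ∀ i → rare i (ω i) ≡ 0
            rare≡0 i = *-small⇒≡0 _ (≤-<-trans (≤-trans (m≤m+n _ _) (m≤n+m _ (a * stray i (ω i)))) (penalty<a i))

          colour : Fin n → Fin q
          colour x with x ∈? F | allBut? x
          ... | yes _ | yes (i , _) = i
          -- Only vertices of `Z` arrive here; their colour is a placeholder.
          ... | yes _ | no _        = leader x
          ... | no _  | _           = leader x

          private
            colour-F : ∀ {x} → x ∈ˢ F → x ∉ Z → AllBut x (colour x)
            colour-F {x} x∈F x∉Z with x ∈? F | allBut? x in eq
            ... | yes _  | yes (_ , allBut) = allBut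
            ... | yes _  | no ¬allBut       = contradiction (select⁺ bad? (x∈F , ¬allBut)) x∉Z
            ... | no x∉F | _                = contradiction x∈F x∉F

            colour-∁F : ∀ {x} → x ∉ F → colour x ≡ leader x
            colour-∁F {x} x∉F with x ∈? F | allBut? x
            ... | yes x∈F | _ = contradiction x∈F x∉F
            ... | no _    | _ = refl

          -- The point `ω j` is good for `T = E ∩ F`, so `T` is not rare. But a good point lies in
          -- all events of `E` or misses a vertex of `E` outside `F′`, and both have so little
          -- measure that `T` is rare.
          independent : ∀ {i j} E → ∣ E ∣ ≤ r → j ≢ i → N * ρ∩ j E ≤ D →
                        ¬ (∀ {x} → x ∈ˢ E → x ∉ Z × colour x ≡ i)
          independent {i} {j} E ∣E∣≤r j≢i E-null coloured = <⇒≱ T-frequent T-rare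
            where
            T = E ∩ F

            G : ℕ
            G = μ.∫ j (𝟙 ∘ good? j T)

            ω-good : Good j T (ω j)
            ω-good = strays-ok , T-ok
              where
              strays-ok : Common j (strays j) (ω j)
              strays-ok x x∈ with ∈A? x j
              ... | yes ∈A = ∈A
              ... | no ∉A  = contradiction
                (≤-trans (miss-yes ∉A) (≤-trans (term≤∑∈ (strays j) (λ x → miss j x (ω j)) x∈) (≤-reflexive (stray≡0 j)))) λ ()
              T-ok : Common j T (ω j)
              T-ok x x∈T with x∈E , x∈F ← x∈p∩q⁻ E F x∈T with x∉Z , refl ← coloured x∈E =
                colour-F x∈F x∉Z j j≢i

            T-frequent : D < p * G
            T-frequent = ≰⇒> λ isRare → contradiction (begin
              1                                        ≡⟨ cong₂ _*_ (𝟙-yes (rare? j T) isRare) (𝟙-yes (good? j T (ω j)) ω-good) ⟨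
              𝟙 (rare? j T) * 𝟙 (good? j T (ω j))      ≤⟨ term≤∑⊆ (λ T → 𝟙 (rare? j T) * 𝟙 (good? j T (ω j))) (p∩q⊆q E F) ⟩
              rare j (ω j)                             ≡⟨ rare≡0 j ⟩
              0                                        ∎) λ ()
              where open ≤-Reasoning

            outer? : ∀ x → Dec (x ∈ˢ E × x ∉ F′)
            outer? x = (x ∈? E) ×-dec ¬? (x ∈? F′)

            U = select outer?

            j≢leader : ∀ {x} → x ∈ˢ E → x ∉ F → j ≢ leader x
            j≢leader x∈E x∉F j≡ℓ =
              j≢i (trans j≡ℓ (trans (sym (colour-∁F x∉F)) (proj₂ (coloured x∈E))))

            -- A vertex of `E` that `ν` misses is not in `F`, as `ν` lies in the events of `T`. It
            -- is not in `B` either: outside `F` the colour `i` is the leader, so such a vertex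
            -- would belong to `strays j`.
            good⇒ : ∀ ν → 𝟙 (good? j T ν) ≤ 𝟙 (common? j E ν) + ∑∈ U λ x → miss j x ν
            good⇒ ν = 𝟙-≤ (good? j T ν) (λ good → lemma good (common? j E ν))
              where
              lemma : Good j T ν → (d : Dec (Common j E ν)) → 1 ≤ 𝟙 d + ∑∈ U λ x → miss j x ν
              lemma _ (yes _) = s≤s z≤n
              lemma (strays-ok , T-ok) (no ¬E-ok)
                with x , ¬imp ← ¬∀⟶∃¬ _ _ (λ x → (x ∈? E) →-dec (ν ∈? A j x)) ¬E-ok = begin
                1                             ≡⟨ 𝟙-yes (¬? (ν ∈? A j x)) ∉A ⟨
                miss j x ν                    ≤⟨ term≤∑∈ U (λ x → miss j x ν) (select⁺ outer? (x∈E , x∉F′)) ⟩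
                ∑∈ U (λ x → miss j x ν)       ∎
                where
                open ≤-Reasoning
                ∉A : ν ∉ A j x
                ∉A ∈A = ¬imp λ _ → ∈A
                x∈E : x ∈ˢ E
                x∈E = decidable-stable (x ∈? E) λ x∉E → ¬imp λ x∈E → contradiction x∈E x∉E
                x∉F : x ∉ F
                x∉F x∈F = ∉A (T-ok x (x∈p∩q⁺ (x∈E , x∈F)))
                x∉F′ : x ∉ F′
                x∉F′ x∈F′ = ∉A (strays-ok x (select⁺ (strays? j)
                  (select⁺ band? (x∈F′ , x∉F) , j≢leader x∈E x∉F)))

            -- Here `H x` is at most `1 / c`, hence at most `1 / (2 * p * r)`, and as `j` does not
            -- lead `x`, the complement has measure at most `H x + 1 / N`.
            outer-small : ∀ {x} → x ∈ˢ U → 2 * (p * r) * N * ρᶜ j x ≤ N * D + 2 * (p * r) * D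
            outer-small {x} x∈U with x∈E , x∉F′ ← select⁻ outer? x∈U = begin
              2 * (p * r) * N * ρᶜ j x                 ≡⟨ *-assoc (2 * (p * r)) N _ ⟩
              2 * (p * r) * (N * ρᶜ j x)               ≤⟨ *-monoʳ-≤ (2 * (p * r)) (ρᶜ-small (j≢leader x∈E (x∉F′ ∘ F⊆F′))) ⟩
              2 * (p * r) * (N * H x + D)              ≡⟨ lemma (2 * (p * r)) N (H x) D ⟩
              N * (2 * (p * r) * H x) + 2 * (p * r) * D
                ≤⟨ +-monoˡ-≤ _ (*-monoʳ-≤ N (≤-trans (*-monoˡ-≤ (H x) 2pr≤c) (outer x∉F′))) ⟩
              N * D + 2 * (p * r) * D                  ∎
              where
              open ≤-Reasoning
              lemma : ∀ s x h d → s * (x * h + d) ≡ x * (s * h) + s * d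
              lemma = solve-∀

            ∑outer : 2 * p * N * ∑∈ U (ρᶜ j) ≤ N * D + 2 * (p * r) * D
            ∑outer = *-cancelˡ-≤ r (begin
              r * (2 * p * N * ∑∈ U (ρᶜ j))            ≡⟨ lemma r p N (∑∈ U (ρᶜ j)) ⟩
              2 * (p * r) * N * ∑∈ U (ρᶜ j)            ≤⟨ ∑∈-bound U (ρᶜ j) {2 * (p * r) * N} outer-small ⟩
              ∣ U ∣ * (N * D + 2 * (p * r) * D)        ≤⟨ *-monoˡ-≤ (N * D + 2 * (p * r) * D)
                                                            (≤-trans (p⊆q⇒∣p∣≤∣q∣ {p = U} {E} (proj₁ ∘ select⁻ outer?)) ∣E∣≤r) ⟩
              r * (N * D + 2 * (p * r) * D)            ∎)
              where
              open ≤-Reasoning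
              lemma : ∀ x y z s → x * (2 * y * z * s) ≡ 2 * (y * x) * z * s
              lemma = solve-∀

            -- The events of `E` meet in measure at most `1 / N`, and the outer vertices cost at
            -- most `1 / (2 * p) + r / N`. The terms in `1 / N` add up to at most another
            -- `1 / (2 * p)`.
            T-rare : p * G ≤ D
            T-rare = *-cancelˡ-≤ (2 * N) {{m*n≢0 2 N}} (begin
              2 * N * (p * G)
                ≤⟨ *-monoʳ-≤ (2 * N) (*-monoʳ-≤ p (μ.mono j good⇒)) ⟩
              2 * N * (p * μ.∫ j λ ν → 𝟙 (common? j E ν) + ∑∈ U λ x → miss j x ν)
                ≡⟨ cong (λ s → 2 * N * (p * s)) (trans (μ.+-hom j (𝟙 ∘ common? j E) _)
                     (cong (ρ∩ j E +_) (∑∈-hom (μ.∫-linear j) U (miss j)))) ⟩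
              2 * N * (p * (ρ∩ j E + ∑∈ U (ρᶜ j)))
                ≡⟨ lemma₁ N p (ρ∩ j E) (∑∈ U (ρᶜ j)) ⟩
              2 * p * (N * ρ∩ j E) + 2 * p * N * ∑∈ U (ρᶜ j)
                ≤⟨ +-mono-≤ (*-monoʳ-≤ (2 * p) E-null) ∑outer ⟩
              2 * p * D + (N * D + 2 * (p * r) * D)
                ≡⟨ lemma₂ N p r D ⟩
              N * D + 2 * (p * suc r) * D
                ≤⟨ +-monoʳ-≤ (N * D) (*-monoˡ-≤ D 2p⟨1+r⟩≤N) ⟩
              N * D + N * D
                ≡⟨ lemma₃ N D ⟩
              2 * N * D ∎)
              where
              open ≤-Reasoning
              lemma₁ : ∀ x y s t → 2 * x * (y * (s + t)) ≡ 2 * y * (x * s) + 2 * y * x * t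
              lemma₁ = solve-∀
              lemma₂ : ∀ x y z d → 2 * y * d + (x * d + 2 * (y * z) * d) ≡ x * d + 2 * (y * suc z) * d
              lemma₂ = solve-∀
              lemma₃ : ∀ x d → x * d + x * d ≡ 2 * x * d
              lemma₃ = solve-∀

-- Constants and the choice of a light band.

module Constants (q a r : ℕ) where

  θ κ K M N : ℕ
  θ = 8 * (q * a)
  κ = 3 ^ q * suc a
  K = κ * θ

  -- With `F` the level at `scale k`, `frequency k` is the value of `p`: since `∣ F ∣` is at most
  -- `κ * scale k`, it is at least `θ * 2 ^ ∣ F ∣`. The next scale then exceeds `2 * (p * r)`.
  scale frequency : ℕ → ℕ
  scale zero    = 1
  scale (suc k) = scale k + 2 * (frequency k * r)
  frequency k   = θ * 2 ^ (κ * scale k)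

  -- `M` bounds the sizes of all levels up to `K`. The summands of `N` give `N` at least 3, the
  -- condition on `p * suc r`, and the conditions on sizes of levels.
  M = κ * scale K
  N = 3 + (2 * (scale K * suc r) + θ * (suc M * 2 ^ suc M))

  scale-mono : ∀ {k l} → k ≤ l → scale k ≤ scale l
  scale-mono k≤l = go (≤⇒≤′ k≤l)
    where
    go : ∀ {k l} → k ≤′ l → scale k ≤ scale l
    go (≤′-reflexive refl) = ≤-refl
    go (≤′-step k≤l)       = ≤-trans (go k≤l) (m≤m+n _ _)

module _ {D q n a r : ℕ} .{{_ : NonZero D}} .{{_ : NonZero q}} .{{_ : NonZero a}} .{{_ : NonZero r}}
  where

  open Constants q a r using (θ; K; M; N; scale; frequency; scale-mono)

  private
    instance
      θ≢0 : NonZero θ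
      θ≢0 = m*n≢0 8 (q * a) {{_}} {{m*n≢0 q a}}

    θX≤N : ∀ {x} → x ≤ suc M * 2 ^ suc M → θ * x ≤ N
    θX≤N x≤ = ≤-trans (*-monoʳ-≤ θ x≤) (≤-trans (m≤n+m _ (2 * (scale K * suc r))) (m≤n+m _ 3))

    M-large : ∀ {m} → m ≤ M → suc m * 2 ^ m ≤ suc M * 2 ^ suc M
    M-large m≤M = *-mono-≤ (s≤s m≤M) (^-monoʳ-≤ 2 (m≤n⇒m≤1+n m≤M))

    m≤M⇒m≤ : ∀ {m} → m ≤ M → m ≤ suc M * 2 ^ suc M
    m≤M⇒m≤ {m} m≤M = ≤-trans (m≤n⇒m≤1+n m≤M) (m≤m*n (suc M) (2 ^ suc M) {{m^n≢0 2 (suc M)}})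

    κscale≤M : ∀ {k} → k ≤ K → Constants.κ q a r * scale k ≤ M
    κscale≤M k≤K = *-monoʳ-≤ (Constants.κ q a r) (scale-mono k≤K)

  partition′ :
    (μ : Fin q → Weighting D) (A : ∀ i → Fin n → Subset (Weighting.points (μ i))) →
    let open Family {N = N} {a = a} (s≤s (s≤s (s≤s z≤n))) μ A in
    (∀ x → N * ∑ (λ i → ρᶜ i x) ≤ suc N * D) →
    (∀ S → ∣ S ∣ ≡ a → ∃ λ i → N * ρ∩ i S ≤ D) →
    ∃ λ (Z : Subset n) → ∣ Z ∣ ≤ a ∸ 1 × ∃ λ (colour : Fin n → Fin q) →
    ∀ {i j} E → ∣ E ∣ ≤ r → j ≢ i → N * ρ∩ j E ≤ D → ¬ (∀ {x} → x ∈ˢ E → x ∉ Z × colour x ≡ i)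
  partition′ μ A A1 A2 = Z , ∣Z∣≤a-1 , colour , independent
    where
    open Family {N = N} {a = a} (s≤s (s≤s (s≤s z≤n))) μ A hiding (κ)

    κ : ℕ
    κ = Constants.κ q a r

    F : ℕ → Subset n
    F k = level A1 A2 (scale k)

    ∣F∣≤ : ∀ {k} → k ≤ K → ∣ F k ∣ ≤ κ * scale k
    ∣F∣≤ {k} k≤K = ∣level∣ A1 A2 (scale k) (≤-trans
      (*-mono-≤ (s≤s (κscale≤M k≤K)) (^-monoʳ-≤ 2 (s≤s (κscale≤M k≤K))))
      (≤-trans (m≤n*m _ θ) (θX≤N ≤-refl)))

    ∣F∣≤M : ∀ {k} → k ≤ K → ∣ F k ∣ ≤ M
    ∣F∣≤M k≤K = ≤-trans (∣F∣≤ k≤K) (κscale≤M k≤K)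

    g : ℕ → ℕ
    g k = ∑∈ (F k) H

    gK≤ : g K ≤ κ * D
    gK≤ = ∑H-bound A1 A2 (F K) (begin
      ∣ F K ∣ * 2 ^ ∣ F K ∣            ≤⟨ *-monoˡ-≤ (2 ^ ∣ F K ∣) (n≤1+n ∣ F K ∣) ⟩
      suc ∣ F K ∣ * 2 ^ ∣ F K ∣        ≤⟨ m≤n*m _ θ ⟩
      θ * (suc ∣ F K ∣ * 2 ^ ∣ F K ∣)  ≤⟨ θX≤N (M-large (∣F∣≤M ≤-refl)) ⟩
      N                                ∎)
      where open ≤-Reasoning

    -- `K` increments above `D` would push `θ * g K` beyond `K * D`, that is `θ * (κ * D)`, against
    -- `gK≤`.
    gap : ∃ λ k → k < K × θ * g (suc k) ≤ θ * g k + D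
    gap with small-increment g θ D K
    ... | inj₁ found = found
    ... | inj₂ large = contradiction (*-cancelˡ-≤ K {{m*n≢0 κ θ {{κ≢0}}}} (begin
      K * suc D        ≤⟨ large ⟩
      θ * g K          ≤⟨ *-monoʳ-≤ θ gK≤ ⟩
      θ * (κ * D)      ≡⟨ lemma θ κ D ⟩
      K * D            ∎)) (<⇒≱ ≤-refl)
      where
      open ≤-Reasoning
      κ≢0 : NonZero κ
      κ≢0 = m*n≢0 (3 ^ q) (suc a) {{m^n≢0 3 q}}
      lemma : ∀ x y z → x * (y * z) ≡ y * x * z
      lemma = solve-∀

    k : ℕ
    k = proj₁ gap

    k<K : k < K
    k<K = proj₁ (proj₂ gap)

    p : ℕ
    p = frequency k

    F⊆F′ : F k ⊆ F (suc k)
    F⊆F′ {x} x∈F = select⁺ (λ x → D <? scale (suc k) * H x)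
      (<-≤-trans (select⁻ (λ x → D <? scale k * H x) x∈F) (*-monoˡ-≤ (H x) (scale-mono (n≤1+n k))))

    module C = Choice A1 A2 F⊆F′ {p} {r} {scale (suc k)}

    m≤M : ∣ F k ∣ ≤ M
    m≤M = ∣F∣≤M (<⇒≤ k<K)

    8q≤θ : 8 * q ≤ θ
    8q≤θ = *-monoʳ-≤ 8 (m≤m*n q a)

    8m≤N : 8 * ∣ F k ∣ ≤ N
    8m≤N = ≤-trans (*-monoˡ-≤ ∣ F k ∣ (≤-trans (m≤m*n 8 q) 8q≤θ)) (θX≤N (m≤M⇒m≤ m≤M))

    null≤N : 8 * (q * suc ∣ F k ∣) * 2 ^ ∣ F k ∣ ≤ N
    null≤N = begin
      8 * (q * suc ∣ F k ∣) * 2 ^ ∣ F k ∣      ≡⟨ lemma q (suc ∣ F k ∣) (2 ^ ∣ F k ∣) ⟩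
      8 * q * (suc ∣ F k ∣ * 2 ^ ∣ F k ∣)      ≤⟨ *-monoˡ-≤ (suc ∣ F k ∣ * 2 ^ ∣ F k ∣) 8q≤θ ⟩
      θ * (suc ∣ F k ∣ * 2 ^ ∣ F k ∣)          ≤⟨ θX≤N (M-large m≤M) ⟩
      N                                        ∎
      where
      open ≤-Reasoning
      lemma : ∀ x y z → 8 * (x * y) * z ≡ 8 * x * (y * z)
      lemma = solve-∀

    light : θ * ∑∈ C.B H ≤ D
    light = +-cancelˡ-≤ (θ * g k) _ _ (begin
      θ * g k + θ * ∑∈ C.B H    ≡⟨ *-distribˡ-+ θ (g k) _ ⟨
      θ * (g k + ∑∈ C.B H)      ≤⟨ *-monoʳ-≤ θ (∑∈-∪ {R = F k} {C.B} {F (suc k)} H F⊆F′ (proj₁ ∘ select⁻ C.band?)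
                                     (λ x∈F x∈B → proj₂ (select⁻ C.band? x∈B) x∈F)) ⟩
      θ * g (suc k)             ≤⟨ proj₂ (proj₂ gap) ⟩
      θ * g k + D               ∎)
      where open ≤-Reasoning

    2p⟨1+r⟩≤N : 2 * (p * suc r) ≤ N
    2p⟨1+r⟩≤N = begin
      2 * (p * suc r)            ≤⟨ *-monoʳ-≤ 2 (*-monoˡ-≤ (suc r) (begin
        p                          ≤⟨ m≤m*n p r ⟩
        p * r                      ≤⟨ m≤n*m (p * r) 2 ⟩
        2 * (p * r)                ≤⟨ m≤n+m _ (scale k) ⟩
        scale (suc k)              ≤⟨ scale-mono k<K ⟩
        scale K                    ∎)) ⟩
      2 * (scale K * suc r)      ≤⟨ m≤m+n _ _ ⟩
      2 * (scale K * suc r) + θ * (suc M * 2 ^ suc M)   ≤⟨ m≤n+m _ 3 ⟩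
      N                          ∎
      where open ≤-Reasoning

    open C.Sampled 8m≤N
      (θX≤N (m≤M⇒m≤ (∣F∣≤M k<K)))
      null≤N
      light
      (*-monoʳ-≤ θ (^-monoʳ-≤ 2 (∣F∣≤ (<⇒≤ k<K))))
      (m≤n+m (2 * (p * r)) (scale k))
      2p⟨1+r⟩≤N
      (λ x∉F′ → ≮⇒≥ (x∉F′ ∘ select⁺ (λ x → D <? scale (suc k) * H x)))

-- Abstract because unfolding the tower of exponentials makes type checking infeasible.
abstract
  tolerance : ℕ → ℕ → ℕ → ℕ
  tolerance q a r = pred (Constants.N q a r)

  3≤tolerance : ∀ q a r → 3 ≤ suc (tolerance q a r)
  3≤tolerance q a r = s≤s (s≤s (s≤s z≤n))

  partition : ∀ {D q n a r} .{{_ : NonZero D}} .{{_ : NonZero q}} .{{_ : NonZero a}} .{{_ : NonZero r}} →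
    let N = suc (tolerance q a r) in
    (μ : Fin q → Weighting D) (A : ∀ i → Fin n → Subset (Weighting.points (μ i))) →
    let open Family {N = N} {a = a} (3≤tolerance q a r) μ A in
    (∀ x → N * ∑ (λ i → ρᶜ i x) ≤ suc N * D) →
    (∀ S → ∣ S ∣ ≡ a → ∃ λ i → N * ρ∩ i S ≤ D) →
    ∃ λ (Z : Subset n) → ∣ Z ∣ ≤ a ∸ 1 × ∃ λ (colour : Fin n → Fin q) →
    ∀ {i j} E → ∣ E ∣ ≤ r → j ≢ i → N * ρ∩ j E ≤ D → ¬ (∀ {x} → x ∈ˢ E → x ∉ Z × colour x ≡ i)
  partition = partition′

-- Multiples of `δ d` as bounds for real numbers.

abstract
  ·δ-fraction : ∀ d k → toℚᵘ (k · δ d) ℚᵘ.≃ mkℚᵘ (+ℤ k) d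
  ·δ-fraction d zero    = *≡* refl
  ·δ-fraction d (suc k) = begin
    toℚᵘ (δ d ℚ.+ k · δ d)              ≈⟨ ℚ.toℚᵘ-homo-+ (δ d) (k · δ d) ⟩
    mkℚᵘ 1ℤ d ℚᵘ.+ toℚᵘ (k · δ d)       ≈⟨ ℚᵘ.+-congʳ (mkℚᵘ 1ℤ d) (·δ-fraction d k) ⟩
    mkℚᵘ 1ℤ d ℚᵘ.+ mkℚᵘ (+ℤ k) d         ≈⟨ *≡* cross ⟩
    mkℚᵘ (+ℤ suc k) d                    ∎
    where
    open ℚᵘ.≃-Reasoning
    crossℕ : ∀ k d → (1 * suc d + k * suc d) * suc d ≡ suc k * (suc d * suc d)
    crossℕ = solve-∀
    cross : (1ℤ ℤ.* +ℤ suc d ℤ.+ +ℤ k ℤ.* +ℤ suc d) ℤ.* +ℤ suc d ≡ +ℤ suc k ℤ.* +ℤ (suc d * suc d)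
    cross = trans (cong (ℤ._* +ℤ suc d) (cong₂ ℤ._+_ (sym (ℤ.pos-* 1 (suc d))) (sym (ℤ.pos-* k (suc d)))))
      (trans (sym (ℤ.pos-* (1 * suc d + k * suc d) (suc d)))
        (trans (cong +ℤ_ (crossℕ k d)) (ℤ.pos-* (suc k) (suc d * suc d))))

  ·δ≡ : ∀ d k (p : ℚ) {l e} → toℚᵘ p ℚᵘ.≃ mkℚᵘ (+ℤ l) e → k * suc e ≡ l * suc d → k · δ d ≡ p
  ·δ≡ d k p {l} {e} p≃ eq = ℚ.toℚᵘ-injective (begin
    toℚᵘ (k · δ d)     ≈⟨ ·δ-fraction d k ⟩
    mkℚᵘ (+ℤ k) d       ≈⟨ *≡* (trans (sym (ℤ.pos-* k (suc e))) (trans (cong +ℤ_ eq) (ℤ.pos-* l (suc d)))) ⟩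
    mkℚᵘ (+ℤ l) e       ≈⟨ p≃ ⟨
    toℚᵘ p             ∎)
    where open ℚᵘ.≃-Reasoning

  archimedean : ∀ d p → ∃ λ k → p ℚ.< k · δ d
  archimedean d p@(mkℚ m e _) = k , ℚ.toℚᵘ-cancel-< (ℚᵘ.<-respʳ-≃ (ℚᵘ.≃-sym (·δ-fraction d k)) (*<* lt))
    where
    open ℤ.≤-Reasoning
    k : ℕ
    -- Then `k · δ d` is `∣ m ∣ + 1`, which exceeds the numerator's absolute value and hence `p`.
    k = suc ℤ.∣ m ∣ * suc d
    i≤∣i∣ : ∀ i → i ℤ.≤ +ℤ ℤ.∣ i ∣
    i≤∣i∣ (+ℤ _)      = ℤ.≤-refl
    i≤∣i∣ ℤ.-[1+ _ ] = ℤ.-≤+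
    lt : m ℤ.* +ℤ suc d ℤ.< +ℤ k ℤ.* +ℤ suc e
    lt = begin-strict
      m ℤ.* +ℤ suc d                  ≤⟨ ℤ.*-monoʳ-≤-nonNeg (+ℤ suc d) (i≤∣i∣ m) ⟩
      +ℤ ℤ.∣ m ∣ ℤ.* +ℤ suc d          ≡⟨ ℤ.pos-* ℤ.∣ m ∣ (suc d) ⟨
      +ℤ (ℤ.∣ m ∣ * suc d)            <⟨ ℤ.+<+ (*-monoˡ-< (suc d) (n<1+n ℤ.∣ m ∣)) ⟩
      +ℤ k                            ≤⟨ ℤ.+≤+ (m≤m*n k (suc e)) ⟩
      +ℤ (k * suc e)                  ≡⟨ ℤ.pos-* k (suc e) ⟩
      +ℤ k ℤ.* +ℤ suc e                ∎

  0<δ : ∀ d → 0ℚ ℚ.< δ d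
  0<δ d = ℚ.positive⁻¹ (δ d)

  p≤δ+p : ∀ d p → p ℚ.≤ δ d ℚ.+ p
  p≤δ+p d p = ℚ.≤-trans (ℚ.≤-reflexive (sym (ℚ.+-identityˡ p))) (ℚ.+-monoˡ-≤ p (0≤δ d))

  ·δ-mono : ∀ d {k l} → k ≤ l → k · δ d ℚ.≤ l · δ d
  ·δ-mono d {l = zero}  z≤n = ℚ.≤-refl
  ·δ-mono d {l = suc l} z≤n = ℚ.≤-trans (·δ-mono d {l = l} z≤n) (p≤δ+p d _)
  ·δ-mono d (s≤s k≤l)       = ℚ.+-monoʳ-≤ (δ d) (·δ-mono d k≤l)

2δ : ℕ → ℚ
2δ n = δ n ℚ.+ δ n

abstract
  +ℝ-mono : ∀ {x x′ y y′} → x ≤ℝ x′ → y ≤ℝ y′ → x +ℝ y ≤ℝ x′ +ℝ y′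
  +ℝ-mono {x} {x′} {y} {y′} x≤x′ y≤y′ n = begin
    seq x k ℚ.+ seq y k                                  ≤⟨ ℚ.+-mono-≤ (x≤x′ k) (y≤y′ k) ⟩
    (seq x′ k ℚ.+ 2δ k) ℚ.+ (seq y′ k ℚ.+ 2δ k)          ≡⟨ rearrange (seq x′ k) (seq y′ k) (δ k) ⟩
    (seq x′ k ℚ.+ seq y′ k) ℚ.+ (2δ k ℚ.+ 2δ k)          ≡⟨ cong (λ e → (seq x′ k ℚ.+ seq y′ k) ℚ.+ (e ℚ.+ e)) (δ-double n) ⟩
    (seq x′ k ℚ.+ seq y′ k) ℚ.+ 2δ n                     ∎
    where
    open ℚ.≤-Reasoning
    k : ℕ
    k = double n
    rearrange : ∀ s t z → (s ℚ.+ (z ℚ.+ z)) ℚ.+ (t ℚ.+ (z ℚ.+ z)) ≡ (s ℚ.+ t) ℚ.+ ((z ℚ.+ z) ℚ.+ (z ℚ.+ z))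
    rearrange = solve 3 (λ s t z → (s :+ (z :+ z)) :+ (t :+ (z :+ z)) := (s :+ t) :+ ((z :+ z) :+ (z :+ z))) refl
      where open ℚ.+-*-Solver

  -ℝ-anti : ∀ {x y} → x ≤ℝ y → -ℝ y ≤ℝ -ℝ x
  -ℝ-anti {x} {y} x≤y n = begin
    ℚ.- seq y n                            ≡⟨ shift (seq y n) (2δ n) ⟩
    ℚ.- (seq y n ℚ.+ 2δ n) ℚ.+ 2δ n        ≤⟨ ℚ.+-monoˡ-≤ (2δ n) (ℚ.neg-antimono-≤ (x≤y n)) ⟩
    ℚ.- seq x n ℚ.+ 2δ n                   ∎
    where
    open ℚ.≤-Reasoning
    shift : ∀ a c → ℚ.- a ≡ ℚ.- (a ℚ.+ c) ℚ.+ c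
    shift = solve 2 (λ a c → :- a := :- (a :+ c) :+ c) refl
      where open ℚ.+-*-Solver

  ≤ℝ-refl : ∀ x → x ≤ℝ x
  ≤ℝ-refl x n = begin
    seq x n                  ≡⟨ ℚ.+-identityʳ (seq x n) ⟨
    seq x n ℚ.+ 0ℚ           ≤⟨ ℚ.+-monoʳ-≤ (seq x n) (ℚ.+-mono-≤ (0≤δ n) (0≤δ n)) ⟩
    seq x n ℚ.+ 2δ n         ∎
    where open ℚ.≤-Reasoning

  ⊓ℝ-glb : ∀ {x y z} → x ≤ℝ y → x ≤ℝ z → x ≤ℝ y ⊓ℝ z
  ⊓ℝ-glb {x} {y} {z} x≤y x≤z n with ℚ.⊓-sel (seq y n) (seq z n)
  ... | inj₁ eq = subst (λ s → seq x n ℚ.≤ s ℚ.+ 2δ n) (sym eq) (x≤y n)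
  ... | inj₂ eq = subst (λ s → seq x n ℚ.≤ s ℚ.+ 2δ n) (sym eq) (x≤z n)

  -- Six errors δ ν are strictly less than 8 δ ν = δ d for ν = 8 d + 7.
  squeeze : ∀ d {k l} {x y : ℝ} → fromℚ (k · δ d) ≤ℝ x → x ≤ℝ y → y ≤ℝ fromℚ (l · δ d) → k ≤ l
  squeeze d {k} {l} {x} {y} k≤x x≤y y≤l = ≮⇒≥ λ l<k → ℚ.<-irrefl refl (begin-strict
    k · δ d                                           ≤⟨ k≤x ν ⟩
    seq x ν ℚ.+ 2δ ν                                  ≤⟨ ℚ.+-monoˡ-≤ (2δ ν) (x≤y ν) ⟩
    seq y ν ℚ.+ 2δ ν ℚ.+ 2δ ν                         ≤⟨ ℚ.+-monoˡ-≤ (2δ ν) (ℚ.+-monoˡ-≤ (2δ ν) (y≤l ν)) ⟩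
    l · δ d ℚ.+ 2δ ν ℚ.+ 2δ ν ℚ.+ 2δ ν                ≡⟨ ℚ.+-identityʳ _ ⟨
    l · δ d ℚ.+ 2δ ν ℚ.+ 2δ ν ℚ.+ 2δ ν ℚ.+ 0ℚ         <⟨ ℚ.+-monoʳ-< (l · δ d ℚ.+ 2δ ν ℚ.+ 2δ ν ℚ.+ 2δ ν) 0<2δ ⟩
    l · δ d ℚ.+ 2δ ν ℚ.+ 2δ ν ℚ.+ 2δ ν ℚ.+ 2δ ν       ≡⟨ gather (l · δ d) (2δ ν) ⟩
    (2δ ν ℚ.+ 2δ ν) ℚ.+ (2δ ν ℚ.+ 2δ ν) ℚ.+ l · δ d   ≡⟨ cong (ℚ._+ l · δ d) eighths ⟩
    suc l · δ d                                       ≤⟨ ·δ-mono d l<k ⟩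
    k · δ d                                           ∎)
    where
    open ℚ.≤-Reasoning
    ν : ℕ
    ν = double (double (double d))
    0<2δ : 0ℚ ℚ.< 2δ ν
    0<2δ = ℚ.+-mono-< (0<δ ν) (0<δ ν)
    gather : ∀ s t → s ℚ.+ t ℚ.+ t ℚ.+ t ℚ.+ t ≡ (t ℚ.+ t) ℚ.+ (t ℚ.+ t) ℚ.+ s
    gather = solve 2 (λ s t → s :+ t :+ t :+ t :+ t := (t :+ t) :+ (t :+ t) :+ s) refl
      where open ℚ.+-*-Solver
    eighths : (2δ ν ℚ.+ 2δ ν) ℚ.+ (2δ ν ℚ.+ 2δ ν) ≡ δ d
    eighths = trans (cong (λ e → (e ℚ.+ e) ℚ.+ (e ℚ.+ e)) (δ-double (double (double d))))
      (trans (cong (λ e → e ℚ.+ e) (δ-double (double d))) (δ-double d))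

module Grid (d : ℕ) where

  infix 4 _≤ˡ_ _≤ᵘ_

  _≤ˡ_ : ℕ → ℝ → Set
  k ≤ˡ x = fromℚ (k · δ d) ≤ℝ x

  _≤ᵘ_ : ℝ → ℕ → Set
  x ≤ᵘ k = x ≤ℝ fromℚ (k · δ d)

  abstract
    +-≤ˡ : ∀ {k l x y} → k ≤ˡ x → l ≤ˡ y → k + l ≤ˡ x +ℝ y
    +-≤ˡ {k} {l} {x} {y} k≤x l≤y = subst (λ p → fromℚ p ≤ℝ x +ℝ y) (sym (×-homo-+ (δ d) k l))
      (+ℝ-mono {fromℚ (k · δ d)} {x} {fromℚ (l · δ d)} {y} k≤x l≤y)

    +-≤ᵘ : ∀ {k l x y} → x ≤ᵘ k → y ≤ᵘ l → x +ℝ y ≤ᵘ k + l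
    +-≤ᵘ {k} {l} {x} {y} x≤k y≤l = subst (λ p → x +ℝ y ≤ℝ fromℚ p) (sym (×-homo-+ (δ d) k l))
      (+ℝ-mono {x} {fromℚ (k · δ d)} {y} {fromℚ (l · δ d)} x≤k y≤l)

    ≤ˡ-weaken : ∀ {k l x} → k ≤ l → l ≤ˡ x → k ≤ˡ x
    ≤ˡ-weaken k≤l l≤x n = ℚ.≤-trans (·δ-mono d k≤l) (l≤x n)

    ≤ᵘ-weaken : ∀ {k l x} → k ≤ l → x ≤ᵘ k → x ≤ᵘ l
    ≤ᵘ-weaken k≤l x≤k n = ℚ.≤-trans (x≤k n) (ℚ.+-monoˡ-≤ (2δ n) (·δ-mono d k≤l))

  ∑-≤ˡ : ∀ (k : Fin n → ℕ) f → (∀ i → k i ≤ˡ f i) → ∑ k ≤ˡ sum (map f (allFin n))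
  ∑-≤ˡ {n} k f k≤f = subst (λ xs → ∑ k ≤ˡ sum xs) (sym (map-tabulate id f)) (go k f k≤f)
    where
    go : ∀ {n} (k : Fin n → ℕ) f → (∀ i → k i ≤ˡ f i) → ∑ k ≤ˡ sum (tabulate f)
    go {zero}  k f k≤f = ≤ℝ-refl 0ℝ
    go {suc n} k f k≤f = +-≤ˡ {k zero} {x = f zero} {sum (tabulate (f ∘ suc))} (k≤f zero) (go (k ∘ suc) (f ∘ suc) (k≤f ∘ suc))

  ∑-≤ᵘ : ∀ (k : Fin n → ℕ) f → (∀ i → f i ≤ᵘ k i) → sum (map f (allFin n)) ≤ᵘ ∑ k
  ∑-≤ᵘ {n} k f f≤k = subst (λ xs → sum xs ≤ᵘ ∑ k) (sym (map-tabulate id f)) (go k f f≤k)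
    where
    go : ∀ {n} (k : Fin n → ℕ) f → (∀ i → f i ≤ᵘ k i) → sum (tabulate f) ≤ᵘ ∑ k
    go {zero}  k f f≤k = ≤ℝ-refl 0ℝ
    go {suc n} k f f≤k = +-≤ᵘ {k zero} {x = f zero} {sum (tabulate (f ∘ suc))} (f≤k zero) (go (k ∘ suc) (f ∘ suc) (f≤k ∘ suc))

  -- The element `j` excludes the empty list, on which `minimum` has a placeholder value.
  minimum-≤ˡ : ∀ {I : Set} {k} (f : I → ℝ) is {j} → j ∈ is → (∀ {i} → i ∈ is → k ≤ˡ f i) →
               k ≤ˡ minimum (map f is)
  minimum-≤ˡ f (i ∷ [])     j∈ k≤ = k≤ (here refl)
  minimum-≤ˡ {k = k} f (i ∷ i′ ∷ is) j∈ k≤ = ⊓ℝ-glb {fromℚ (k · δ d)} {f i} {minimum (map f (i′ ∷ is))} (k≤ (here refl))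
    (minimum-≤ˡ {k = k} f (i′ ∷ is) (here refl) (k≤ ∘ there))

  private
    -- A descending search from the given bound. The alternative `l ≡ 0` covers every `p` below
    -- `δ d`, negative ones included.
    floor : ∀ p k → p ℚ.< suc k · δ d → ∃ λ l → p ℚ.≤ suc l · δ d × (l ≡ 0 ⊎ l · δ d ℚ.≤ p)
    floor p zero    p< = zero , ℚ.<⇒≤ p< , inj₁ refl
    floor p (suc k) p< with suc k · δ d ℚ.≤? p
    ... | yes k≤p = suc k , ℚ.<⇒≤ p< , inj₂ k≤p
    ... | no  k≰p = floor p k (ℚ.≰⇒> k≰p)

  abstract
    -- Regularity puts `x` within `δ d` of its term `y`. If `y` lies between `l` and `l + 1` grid
    -- steps, then `x` lies between `l - 1` and `l + 2`, whence the gap 3; for `l = 0` the lower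
    -- bound is `0≤x`.
    approximate : ∀ x → 0ℝ ≤ℝ x → ∃ λ k → k ≤ˡ x × x ≤ᵘ k + 3
    approximate x 0≤x = result (floor y (proj₁ bound) (ℚ.<-≤-trans (proj₂ bound) (p≤δ+p d _)))
      where
      open ℚ.≤-Reasoning
      y : ℚ
      y = seq x d
      bound : ∃ λ k → y ℚ.< k · δ d
      bound = archimedean d y

      upper : ∀ l → y ℚ.≤ suc l · δ d → x ≤ᵘ suc (suc l)
      upper l y≤ n = begin
        seq x n                                       ≤⟨ regular x n d ⟩
        y ℚ.+ (δ n ℚ.+ δ d)                           ≤⟨ ℚ.+-mono-≤ y≤ (ℚ.+-monoˡ-≤ (δ d) (p≤δ+p n (δ n))) ⟩
        suc l · δ d ℚ.+ (2δ n ℚ.+ δ d)                ≡⟨ rearrange (suc l · δ d) (2δ n) (δ d) ⟩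
        suc (suc l) · δ d ℚ.+ 2δ n                    ∎
        where
        rearrange : ∀ a b c → a ℚ.+ (b ℚ.+ c) ≡ c ℚ.+ a ℚ.+ b
        rearrange = solve 3 (λ a b c → a :+ (b :+ c) := c :+ a :+ b) refl
          where open ℚ.+-*-Solver

      lower : ∀ l → suc l · δ d ℚ.≤ y → l ≤ˡ x
      lower l ≤y n = ℚ.≤-trans (cancel (ℚ.≤-trans ≤y (regular x d n))) (ℚ.+-monoʳ-≤ (seq x n) (p≤δ+p n (δ n)))
        where
        cancel : δ d ℚ.+ l · δ d ℚ.≤ seq x n ℚ.+ (δ d ℚ.+ δ n) → l · δ d ℚ.≤ seq x n ℚ.+ δ n
        cancel le = begin
          l · δ d                                          ≡⟨ lemma (δ d) (l · δ d) ⟩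
          ℚ.- δ d ℚ.+ (δ d ℚ.+ l · δ d)                    ≤⟨ ℚ.+-monoʳ-≤ (ℚ.- δ d) le ⟩
          ℚ.- δ d ℚ.+ (seq x n ℚ.+ (δ d ℚ.+ δ n))          ≡⟨ lemma′ (δ d) (seq x n) (δ n) ⟩
          seq x n ℚ.+ δ n                                  ∎
          where
          open ℚ.+-*-Solver
          lemma : ∀ a b → b ≡ ℚ.- a ℚ.+ (a ℚ.+ b)
          lemma = solve 2 (λ a b → b := :- a :+ (a :+ b)) refl
          lemma′ : ∀ a b c → ℚ.- a ℚ.+ (b ℚ.+ (a ℚ.+ c)) ≡ b ℚ.+ c
          lemma′ = solve 3 (λ a b c → :- a :+ (b :+ (a :+ c)) := b :+ c) refl

      result : (∃ λ l → y ℚ.≤ suc l · δ d × (l ≡ 0 ⊎ l · δ d ℚ.≤ y)) → ∃ λ k → k ≤ˡ x × x ≤ᵘ k + 3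
      result (zero  , y≤ , _)         = zero , 0≤x , ≤ᵘ-weaken {x = x} (n≤1+n 2) (upper zero y≤)
      result (suc l , y≤ , inj₂ l≤y)  = l , lower l l≤y , ≤ᵘ-weaken {x = x} (≤-reflexive (+-comm 3 l)) (upper (suc l) y≤)

-- Intersections, unions and edges.

∈-⋂ : ∀ {m} {ω : Fin m} (A : Fin n → Subset m) xs → (∀ {x} → x ∈ xs → ω ∈ˢ A x) → ω ∈ˢ ⋂ (map A xs)
∈-⋂ A []       ω∈ = ∈⊤
∈-⋂ A (x ∷ xs) ω∈ = x∈p∩q⁺ (ω∈ (here refl) , ∈-⋂ A xs (ω∈ ∘ there))

∈-⋃⁺ : ∀ {I : Set} {x : Fin n} (X : I → Subset n) is {i} → i ∈ is → x ∈ˢ X i → x ∈ˢ ⋃ (map X is)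
∈-⋃⁺ X (i ∷ is) (here refl) x∈X = x∈p∪q⁺ (inj₁ x∈X)
∈-⋃⁺ X (i ∷ is) (there i∈)  x∈X = x∈p∪q⁺ (inj₂ (∈-⋃⁺ X is i∈ x∈X))

∈-⋃⁻ : ∀ {I : Set} {x : Fin n} (X : I → Subset n) is → x ∈ˢ ⋃ (map X is) → ∃ λ i → x ∈ˢ X i
∈-⋃⁻ X []       x∈ = contradiction x∈ ∉⊥
∈-⋃⁻ X (i ∷ is) x∈ with x∈p∪q⁻ (X i) (⋃ (map X is)) x∈
... | inj₁ x∈X = i , x∈X
... | inj₂ x∈⋃ = ∈-⋃⁻ X is x∈⋃

∣E∣≤rank : ∀ (𝒞 : Hypergraph n) {E} → E ∈ 𝒞 → ∣ E ∣ ≤ rank 𝒞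
∣E∣≤rank (E ∷ 𝒞) (here refl) = m≤m⊔n ∣ E ∣ (rank 𝒞)
∣E∣≤rank (E ∷ 𝒞) (there E∈)  = ≤-trans (∣E∣≤rank 𝒞 E∈) (m≤n⊔m ∣ E ∣ (rank 𝒞))

∣S∣≡k⇒Nonempty : ∀ (S : Subset n) {k} .{{_ : NonZero k}} → ∣ S ∣ ≡ k → Nonempty S
∣S∣≡k⇒Nonempty {n} S {k} ∣S∣≡k with nonempty? S
... | yes S≢∅ = S≢∅
... | no S≡∅  = contradiction
  (trans (sym ∣S∣≡k) (trans (cong ∣_∣ (Empty-unique S≡∅)) (∣⊥∣≡0 n))) (≢-nonZero⁻¹ k)

-- Rounding of real probability spaces to weightings.

abstract
  unit : ∀ d → suc d · δ d ≡ 1ℚ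
  unit d = ·δ≡ d (suc d) 1ℚ {1} {0} ℚᵘ.≃-refl (*-comm (suc d) 1)

  refine : ∀ d ν e → e * suc ν ≡ suc d → e · δ d ≡ δ ν
  refine d ν e eq = ·δ≡ d e (δ ν) {1} {ν} ℚᵘ.≃-refl (trans eq (sym (*-identityˡ (suc d))))

  integer : ∀ d q → (q * suc d) · δ d ≡ +ℤ q ℚ./ 1
  integer d q = ·δ≡ d (q * suc d) (+ℤ q ℚ./ 1) {q} {0} (ℚ.toℚᵘ-fromℚᵘ (mkℚᵘ (+ℤ q) 0)) (*-identityʳ (q * suc d))

  -- At the index `k` with `δ ν` equal to four times `δ k`, the comparison gives away only `2δ k`.
  0<fromℚ-δ : ∀ ν → 0ℝ <ℝ fromℚ (δ ν)
  0<fromℚ-δ ν = k , (begin-strict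
    0ℚ ℚ.+ 2δ k         ≡⟨ ℚ.+-identityˡ (2δ k) ⟩
    2δ k                ≡⟨ ℚ.+-identityʳ (2δ k) ⟨
    2δ k ℚ.+ 0ℚ         <⟨ ℚ.+-monoʳ-< (2δ k) (ℚ.+-mono-< (0<δ k) (0<δ k)) ⟩
    2δ k ℚ.+ 2δ k       ≡⟨ cong (λ e → e ℚ.+ e) (δ-double (double ν)) ⟩
    2δ (double ν)       ≡⟨ δ-double ν ⟩
    δ ν                 ∎)
    where
    open ℚ.≤-Reasoning
    k : ℕ
    k = double (double ν)

-- The masses are rounded down to multiples of δ d; the mass lost is given to an additional sample
-- point, which belongs to no event.
module Rounding (d : ℕ) (Ω : FiniteProbabilitySpace) where

  open Grid d

  private
    w : Fin (size Ω) → ℕ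
    w ω = proj₁ (approximate (mass Ω ω) (mass-≥0 Ω ω))

    w≤mass : ∀ ω → w ω ≤ˡ mass Ω ω
    w≤mass ω = proj₁ (proj₂ (approximate (mass Ω ω) (mass-≥0 Ω ω)))

    mass≤w+3 : ∀ ω → mass Ω ω ≤ᵘ w ω + 3
    mass≤w+3 ω = proj₂ (proj₂ (approximate (mass Ω ω) (mass-≥0 Ω ω)))

    ∑w≤ : ∑ w ≤ suc d
    ∑w≤ = squeeze d {x = sum (map (mass Ω) (allFin (size Ω)))} {1ℝ} (∑-≤ˡ w (mass Ω) w≤mass) (proj₁ (mass-sum Ω))
      (subst (λ p → 1ℝ ≤ℝ fromℚ p) (sym (unit d)) (≤ℝ-refl 1ℝ))

  rounded : Weighting (suc d)
  rounded = record
    { points = suc (size Ω)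
    ; weight = λ { zero → suc d ∸ ∑ w ; (suc ω) → w ω }
    ; total  = m∸n+n≡m ∑w≤
    }

  open Weighting rounded using (∫)

  -- Rounding down only loses mass, and `¬ P zero` keeps out the mass of the additional point, so no
  -- error term arises.
  ∫-≤ˡ : {P : Fin (suc (size Ω)) → Set} (P? : ∀ ω → Dec (P ω)) (B : Event Ω) →
         ¬ P zero → (∀ {ω} → P (suc ω) → ω ∈ˢ B) → ∫ (𝟙 ∘ P?) ≤ˡ ℙ Ω B
  ∫-≤ˡ P? B ¬P₀ P⇒B = subst (_≤ˡ ℙ Ω B) (sym ∫≡) (∑-≤ˡ (λ ω → w ω * 𝟙 (P? (suc ω))) _ λ ω →
      term ω (P? (suc ω)) (Vec.lookup B ω) ([]=⇒lookup ∘ P⇒B))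
    where
    ∫≡ : ∫ (𝟙 ∘ P?) ≡ ∑ λ ω → w ω * 𝟙 (P? (suc ω))
    ∫≡ = cong (_+ ∑ λ ω → w ω * 𝟙 (P? (suc ω)))
           (trans (cong ((suc d ∸ ∑ w) *_) (𝟙-no (P? zero) ¬P₀)) (*-zeroʳ (suc d ∸ ∑ w)))
    term : ∀ ω {P : Set} (e : Dec P) b → (P → b ≡ true) → w ω * 𝟙 e ≤ˡ (if b then mass Ω ω else 0ℝ)
    term ω (yes _) true  _   = subst (_≤ˡ mass Ω ω) (sym (*-identityʳ (w ω))) (w≤mass ω)
    term ω (yes p) false P⇒b = contradiction (P⇒b p) λ ()
    term ω (no _)  true  _   = subst (_≤ˡ mass Ω ω) (sym (*-zeroʳ (w ω))) (mass-≥0 Ω ω)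
    term ω (no _)  false _   = subst (_≤ˡ 0ℝ) (sym (*-zeroʳ (w ω))) (≤ℝ-refl 0ℝ)

  -- Each mass exceeds its rounded value by at most three grid steps, hence the error 3 per sample
  -- point.
  ≤ᵘ-∫ : (B : Event Ω) → ℙ Ω B ≤ᵘ ∫ (λ ω → 𝟙 (ω ∈? (outside ∷ B))) + size Ω * 3
  ≤ᵘ-∫ B = subst (ℙ Ω B ≤ᵘ_) ∑≡ (∑-≤ᵘ k _ λ ω → term ω (Vec.lookup B ω) refl)
    where
    in? : ∀ ω → Dec (ω ∈ˢ (outside ∷ B))
    in? ω = ω ∈? (outside ∷ B)
    k : Fin (size Ω) → ℕ
    k ω = w ω * 𝟙 (in? (suc ω)) + 3
    ∑≡ : ∑ k ≡ ∫ (𝟙 ∘ in?) + size Ω * 3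
    ∑≡ = trans (∑-distrib-+ (λ ω → w ω * 𝟙 (in? (suc ω))) (const 3))
      (cong₂ _+_ (cong (_+ ∑ λ ω → w ω * 𝟙 (in? (suc ω))) (sym (*-zeroʳ (suc d ∸ ∑ w)))) (∑-const (size Ω) 3))
    term : ∀ ω b → Vec.lookup B ω ≡ b → (if b then mass Ω ω else 0ℝ) ≤ᵘ k ω
    term ω true  eq = subst (mass Ω ω ≤ᵘ_)
      (cong (_+ 3) (sym (trans (cong (w ω *_) (𝟙-yes (in? (suc ω)) (there (lookup⇒[]= ω B eq)))) (*-identityʳ (w ω)))))
      (mass≤w+3 ω)
    term ω false eq = ≤ᵘ-weaken {l = k ω} {0ℝ} z≤n (≤ℝ-refl 0ℝ)

-- Transfer from weightings to real probability spaces.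

another : ∀ {q} → 2 ≤ q → (i : Fin q) → ∃ λ j → j ≢ i
another (s≤s (s≤s _)) zero    = suc zero , λ ()
another (s≤s (s≤s _)) (suc i) = zero , λ ()

module _ {q a r : ℕ} .{{_ : NonZero q}} .{{_ : NonZero a}} .{{_ : NonZero r}} where

  private
    N : ℕ
    N = suc (tolerance q a r)

  -- The tolerance 1 / (ν + 1) is half of the tolerance 1 / N of `partition`; the other half absorbs
  -- the rounding errors in the first hypothesis.
  ν : ℕ
  ν = pred (2 * N)

  module _ (Ω : Fin q → FiniteProbabilitySpace) (A : (i : Fin q) → Fin n → Event (Ω i))
           (ε : ℝ) (ε≤ε₀ : ε ≤ℝ fromℚ (δ ν)) where

    private
      -- In units of the grid step `δ d`, `errors` bounds the total rounding error and `e` is the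
      -- tolerance `δ ν`. The choice of `d` makes `suc d` equal to `suc ν * e`, so that `δ ν` lies
      -- on the grid and is larger than all rounding errors together.
      errors e d : ℕ
      errors = ∑ λ i → size (Ω i) * 3
      e      = suc errors
      d      = errors + ν * e

    open Grid d

    private
      module R i = Rounding d (Ω i)

      A⁺ : ∀ i → Fin n → Subset (suc (size (Ω i)))
      A⁺ i x = outside ∷ A i x

    open Family {N = N} {a = a} (3≤tolerance q a r) R.rounded A⁺ hiding (κ)

    private
      ε₀-on-grid : e · δ d ≡ δ ν
      ε₀-on-grid = refine d ν e (*-comm e (suc ν))

      Ne≤D : N * e ≤ suc d
      Ne≤D = *-monoˡ-≤ e (m≤m+n N (N + 0))

    deficit : (∀ x → fromℕ q -ℝ 1ℝ -ℝ ε ≤ℝ sum (map (λ i → ℙ (Ω i) (A i x)) (allFin q))) →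
              ∀ x → N * ∑ (λ i → ρᶜ i x) ≤ suc N * suc d
    deficit hyp x = begin
      N * ∑ (λ i → ρᶜ i x)                ≤⟨ *-monoʳ-≤ N ∑ρᶜ≤ ⟩
      N * (errors + (suc d + e))          ≤⟨ *-monoʳ-≤ N (+-monoˡ-≤ (suc d + e) (n≤1+n errors)) ⟩
      N * (e + (suc d + e))               ≡⟨ lemma N e (suc d) ⟩
      -- By the choice of `ν` and `d`, `2 * N * e` computes to `suc d`.
      2 * N * e + N * suc d               ∎
      where
      open ≤-Reasoning
      lemma : ∀ m e d → m * (e + (d + e)) ≡ 2 * m * e + m * d
      lemma = solve-∀

      lhs rhs slack : ℝ
      lhs   = fromℕ q -ℝ 1ℝ -ℝ ε
      rhs   = sum (map (λ i → ℙ (Ω i) (A i x)) (allFin q))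
      -- This is `1 + δ ν`; adding it to both sides removes the subtractions, so that `squeeze` can
      -- compare natural multiples of `δ d`.
      slack = fromℚ ((suc d + e) · δ d)

      u : ℕ
      u = ∑ λ i → ρ i x + size (Ω i) * 3

      rhs≤u : rhs ≤ᵘ u
      rhs≤u = ∑-≤ᵘ (λ i → ρ i x + size (Ω i) * 3) _ λ i → R.≤ᵘ-∫ i (A i x)

      p : ℚ
      p = +ℤ q ℚ./ 1 ℚ.- 1ℚ ℚ.- δ ν

      p≤lhs : fromℚ p ≤ℝ lhs
      p≤lhs = +ℝ-mono {fromℚ (+ℤ q ℚ./ 1 ℚ.- 1ℚ)} {fromℕ q -ℝ 1ℝ} {fromℚ (ℚ.- δ ν)} { -ℝ ε}
        (≤ℝ-refl (fromℚ (+ℤ q ℚ./ 1 ℚ.- 1ℚ))) (-ℝ-anti {ε} {fromℚ (δ ν)} ε≤ε₀)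

      p+slack : p ℚ.+ (suc d + e) · δ d ≡ (q * suc d) · δ d
      p+slack = trans (cong (p ℚ.+_) (trans (×-homo-+ (δ d) (suc d) e) (cong₂ ℚ._+_ (unit d) ε₀-on-grid)))
        (trans (cancel (+ℤ q ℚ./ 1) 1ℚ (δ ν)) (sym (integer d q)))
        where
        open ℚ.+-*-Solver
        cancel : ∀ x y z → x ℚ.- y ℚ.- z ℚ.+ (y ℚ.+ z) ≡ x
        cancel = solve 3 (λ x y z → x :- y :- z :+ (y :+ z) := x) refl

      qD≤ : q * suc d ≤ u + (suc d + e)
      qD≤ = squeeze d {x = lhs +ℝ slack} {rhs +ℝ slack}
        (subst (λ s → fromℚ s ≤ℝ lhs +ℝ slack) p+slack (+ℝ-mono {fromℚ p} {lhs} {slack} {slack} p≤lhs (≤ℝ-refl slack)))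
        (+ℝ-mono {lhs} {rhs} {slack} {slack} (hyp x) (≤ℝ-refl slack))
        (+-≤ᵘ {u} {suc d + e} {rhs} {slack} rhs≤u (≤ℝ-refl slack))

      ∑ρᶜ≤ : ∑ (λ i → ρᶜ i x) ≤ errors + (suc d + e)
      ∑ρᶜ≤ = +-cancelˡ-≤ (∑ λ i → ρ i x) _ _ (begin
        ∑ (λ i → ρ i x) + ∑ (λ i → ρᶜ i x)            ≡⟨ ∑-distrib-+ (λ i → ρ i x) (λ i → ρᶜ i x) ⟨
        ∑ (λ i → ρ i x + ρᶜ i x)                      ≡⟨ sum-cong-≗ (λ i → ρ+ρᶜ i x) ⟩
        ∑ {q} (λ _ → suc d)                           ≡⟨ ∑-const q (suc d) ⟩
        q * suc d                                     ≤⟨ qD≤ ⟩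
        u + (suc d + e)                               ≡⟨ cong (_+ (suc d + e)) (∑-distrib-+ (λ i → ρ i x) λ i → size (Ω i) * 3) ⟩
        ∑ (λ i → ρ i x) + errors + (suc d + e)        ≡⟨ +-assoc (∑ λ i → ρ i x) errors (suc d + e) ⟩
        ∑ (λ i → ρ i x) + (errors + (suc d + e))      ∎)

    -- If `ρ∩ i S` were above `e` for every listed `i`, the minimum would be at least `suc e` grid
    -- steps, whereas `ε` is at most `e` of them.
    null-coordinate : ∀ (S : Subset n) is {j} → Nonempty S → j ∈ is →
      minimum (map (λ i → ℙ (Ω i) (⋂[ S ] A i)) is) ≤ℝ ε → ∃ λ i → i ∈ is × N * ρ∩ i S ≤ suc d
    null-coordinate S is (x , x∈S) j∈is min≤ε with Any.any? (λ i → ρ∩ i S ≤? e) is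
    ... | yes some with i , i∈is , ≤e ← find some = i , i∈is , ≤-trans (*-monoʳ-≤ N ≤e) Ne≤D
    ... | no none = contradiction (squeeze d {suc e} {e} {minimum (map f is)} {ε}
            (minimum-≤ˡ {k = suc e} f is j∈is large) min≤ε (subst (λ p → ε ≤ℝ fromℚ p) (sym ε₀-on-grid) ε≤ε₀))
            (<⇒≱ ≤-refl)
      where
      f : Fin q → ℝ
      f i = ℙ (Ω i) (⋂[ S ] A i)

      large : ∀ {i} → i ∈ is → suc e ≤ˡ f i
      large {i} i∈is = ≤ˡ-weaken {suc e} {ρ∩ i S} {f i} (≰⇒> λ ≤e → none (lose i∈is ≤e))
        -- The additional sample point would lie in an empty intersection; the vertex `x` of `S`
        -- rules this out.
        (R.∫-≤ˡ i (common? i S) (⋂[ S ] A i) (λ all → contradiction (all x x∈S) λ ())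
          λ all → ∈-⋂ (A i) _ λ x∈ → drop-there (all _ (proj₂ (∈-filter⁻ (_∈? S) {xs = allFin n} x∈))))


    private
      Separates : Subset n → (Fin n → Fin q) → Set
      Separates Z colour = ∀ {i j} E → ∣ E ∣ ≤ r → j ≢ i → N * ρ∩ j E ≤ suc d →
                           ¬ (∀ {x} → x ∈ˢ E → x ∉ Z × colour x ≡ i)

    colouring :
      (∀ x → fromℕ q -ℝ 1ℝ -ℝ ε ≤ℝ sum (map (λ i → ℙ (Ω i) (A i x)) (allFin q))) →
      (∀ (S : Subset n) → ∣ S ∣ ≡ a → minimum (map (λ i → ℙ (Ω i) (⋂[ S ] A i)) (allFin q)) ≤ℝ ε) →
      ∃ λ (Z : Subset n) → ∣ Z ∣ ≤ a ∸ 1 × ∃ λ colour → Separates Z colour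
    colouring A1 A2 = partition {r = r} R.rounded A⁺ (deficit A1) null
      where
      null : ∀ S → ∣ S ∣ ≡ a → ∃ λ i → N * ρ∩ i S ≤ suc d
      null S ∣S∣≡a =
        let i , _ , small = null-coordinate S (allFin q) (∣S∣≡k⇒Nonempty S ∣S∣≡a)
                              (∈-allFin (fromℕ< (>-nonZero⁻¹ q))) (A2 S ∣S∣≡a)
        in i , small

    colour-classes : 2 ≤ q → (𝒞 : Fin q → Hypergraph n) →
      (∀ i E → E ∈ 𝒞 i → Nonempty E) → (∀ i → rank (𝒞 i) ≤ r) →
      (∀ i E → E ∈ 𝒞 i →
        minimum (map (λ j → ℙ (Ω j) (⋂[ E ] A j)) (filter (λ j → ¬? (j ≟ i)) (allFin q))) ≤ℝ ε) →
      ∀ Z colour → Separates Z colour →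
      Σ[ X ∈ (Fin q → Subset n) ] (∀ (i j : Fin q) → i ≢ j → Empty (X i ∩ X j)) ×
        ⋃ (map X (allFin q)) ≡ ∁ Z ×
        (∀ i → Independent (𝒞 i) (X i))
    colour-classes 2≤q 𝒞 nonempty rank≤ A3 Z colour separates = X , disjoint , ⋃X≡∁Z , independent
      where
      part? : ∀ i x → Dec (x ∉ Z × colour x ≡ i)
      part? i x = ¬? (x ∈? Z) ×-dec (colour x ≟ i)

      X : Fin q → Subset n
      X i = select (part? i)

      disjoint : ∀ i j → i ≢ j → Empty (X i ∩ X j)
      disjoint i j i≢j (x , x∈) =
        let x∈Xᵢ , x∈Xⱼ = x∈p∩q⁻ (X i) (X j) x∈
        in i≢j (trans (sym (proj₂ (select⁻ (part? i) x∈Xᵢ))) (proj₂ (select⁻ (part? j) x∈Xⱼ)))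

      ⋃X≡∁Z : ⋃ (map X (allFin q)) ≡ ∁ Z
      ⋃X≡∁Z = ⊆-antisym
        (λ x∈⋃ → let i , x∈X = ∈-⋃⁻ X (allFin q) x∈⋃ in x∉p⇒x∈∁p (proj₁ (select⁻ (part? i) x∈X)))
        (λ {x} x∈∁Z → ∈-⋃⁺ X (allFin q) (∈-allFin (colour x)) (select⁺ (part? (colour x)) (x∈∁p⇒x∉p x∈∁Z , refl)))

      independent : ∀ i → Independent (𝒞 i) (X i)
      independent i E E∈𝒞 E⊆X =
        let others = filter (λ j → ¬? (j ≟ i)) (allFin q)
            -- Some index other than `i` must exist for the minimum in (A3) to run over a nonempty
            -- list.
            j₀ , j₀≢i = another 2≤q i
            j , j∈ , null = null-coordinate E others (nonempty i E E∈𝒞)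
                              (∈-filter⁺ (λ j → ¬? (j ≟ i)) (∈-allFin j₀) j₀≢i) (A3 i E E∈𝒞)
        in separates E (≤-trans (∣E∣≤rank (𝒞 i) E∈𝒞) (rank≤ i))
             (proj₂ (∈-filter⁻ (λ j → ¬? (j ≟ i)) {xs = allFin q} j∈)) null (λ x∈E → select⁻ (part? i) (E⊆X x∈E))

theorem5p2 : (q a r* : ℕ) → 2 ≤ q → 1 ≤ a → 1 ≤ r* →
    Σ[ ε₀ ∈ ℝ ] 0ℝ <ℝ ε₀ ×
    ((n : ℕ)
    (Ω : Fin q → FiniteProbabilitySpace)
    (A : (i : Fin q) → Fin n → Event (Ω i))
    (𝒞 : Fin q → Hypergraph n) →
    (∀ i E → E ∈ 𝒞 i → Nonempty E) →
    (∀ i → rank (𝒞 i) ≤ r*) →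
    (ε : ℝ) → 0ℝ ≤ℝ ε → ε ≤ℝ ε₀ →
    (∀ x → fromℕ q -ℝ 1ℝ -ℝ ε ≤ℝ sum (map (λ i → ℙ (Ω i) (A i x)) (allFin q))) →
    (∀ (S : Subset n) → ∣ S ∣ ≡ a →
    minimum (map (λ i → ℙ (Ω i) (⋂[ S ] A i)) (allFin q)) ≤ℝ ε) →
    (∀ i E → E ∈ 𝒞 i →
    minimum (map (λ j → ℙ (Ω j) (⋂[ E ] A j)) (filter (λ j → ¬? (j ≟ i)) (allFin q))) ≤ℝ ε) →
    Σ[ Z ∈ Subset n ] ∣ Z ∣ ≤ a ∸ 1 ×
    (Σ[ X ∈ (Fin q → Subset n) ] (∀ (i j : Fin q) → i ≢ j → Empty (X i ∩ X j)) ×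
    ⋃ (map X (allFin q)) ≡ ∁ Z ×
    (∀ i → Independent (𝒞 i) (X i))))
-- Matching on the inequalities exposes the successors from which the `NonZero` instances are found.
theorem5p2 (suc (suc q)) (suc a) (suc r) 2≤q@(s≤s (s≤s _)) (s≤s _) (s≤s _) =
  fromℚ (δ ν₀) , 0<fromℚ-δ ν₀ ,
  λ n Ω A 𝒞 nonempty rank≤ ε _ ε≤ε₀ A1 A2 A3 →
    let Z , ∣Z∣≤ , colour , separates = colouring {r = suc r} Ω A ε ε≤ε₀ A1 A2
    in Z , ∣Z∣≤ , colour-classes {a = suc a} {suc r} Ω A ε ε≤ε₀ 2≤q 𝒞 nonempty rank≤ A3 Z colour separates
  where
  ν₀ : ℕ
  ν₀ = ν {suc (suc q)} {suc a} {suc r}
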